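{- Let $p$ be a prime, $R\subseteq\mathbb{F}_p$ the set of quadratic residues and $A\subseteq\mathbb{F}_p$. If $A+A=R$, then $p=3$ and $A=\{2\}$. Moreover, for every $\varepsilon>0$ there is $p_0$ such that for every prime $p>p_0$ and every $A\subseteq\mathbb{F}_p$, $$\max\Big\{|R\setminus(A+A)|,\ \sum_{x\in(A+A)\setminus R}(A*A)(x)\Big\}\ \ge\ \Big(\tfrac16-\varepsilon\Big)|A|.$$
   Context: $R$ is the set of nonzero squares in $\mathbb{F}_p$; $A+A=\{a+a': a,a'\in A\}$; $(A*A)(x)=\sum_{y}A(y)A(x-y)$, i.e. the number of pairs $(a,a')\in A^2$ with $a+a'=x$. -}

module Defs where

open import Data.Bool using (Bool; true; false; _∧_; not)
open import Data.Nat using (ℕ; _+_; _*_; NonZero)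
open import Data.Nat.DivMod using (_mod_)
open import Data.Fin using (Fin; toℕ; _≟_)
open import Data.Fin.Subset using (Subset; ∣_∣; _─_)
open import Data.Vec using (Vec; lookup; tabulate)
open import Data.List using (List; map; allFin)
open import Data.Bool.ListAction using (any)
open import Data.Nat.ListAction using (sum)
open import Relation.Nullary.Decidable using (⌊_⌋)

-- Elements of 𝔽_p are represented by Fin p (residues 0,…,p-1);
-- subsets of 𝔽_p are Subset p (characteristic vectors).

module _ {p : ℕ} .{{_ : NonZero p}} where

  _⊕_ : Fin p → Fin p → Fin p
  x ⊕ y = (toℕ x + toℕ y) mod p

  _⊗_ : Fin p → Fin p → Fin p
  x ⊗ y = (toℕ x * toℕ y) mod p

  mem : Fin p → Subset p → Bool
  mem x A = lookup A x

  QR : Subset p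
  QR = tabulate λ x → not ⌊ toℕ x Data.Nat.≟ 0 ⌋
                       ∧ any (λ y → ⌊ (y ⊗ y) ≟ x ⌋) (allFin p)

  sumset : Subset p → Subset p
  sumset A = tabulate λ x →
    any (λ a → any (λ b → mem a A ∧ mem b A ∧ ⌊ (a ⊕ b) ≟ x ⌋) (allFin p)) (allFin p)

  rep : Subset p → Fin p → ℕ
  rep A x = sum (map (λ a → sum (map (λ b →
              if′ (mem a A ∧ mem b A ∧ ⌊ (a ⊕ b) ≟ x ⌋)) (allFin p))) (allFin p))
    where
    if′ : Bool → ℕ
    if′ true  = 1
    if′ false = 0

  sumOver : Subset p → (Fin p → ℕ) → ℕ
  sumOver S f = sum (map (λ x → g (mem x S) (f x)) (allFin p))
    where
    g : Bool → ℕ → ℕ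
    g true  n = n
    g false _ = 0

{-# OPTIONS --safe #-}

-- Write k = |A|, let χ be the quadratic character and f(x) = Σ_{a∈A} χ(x+a).
-- Then Σ f = 0, and Σ f² ≤ pk - k² because Σ_x χ(x+a) χ(x+b) = -1 for a ≠ b.
-- Let n₁ = |R∖(A+A)| and let n₂ be the number of pairs in A² whose sum is not in R.
-- On A the values of f sum to at least k² - 2n₂, so f ≈ k there and A alone nearly
-- exhausts Σ f²; but then f must be about -k² in total off A, where integrality
-- forces f² ≥ -f. Together these give k³ + 2k² ≤ pk + (4k+2)n₂. On the other hand
-- |A+A| ≤ k(k+1)/2 gives p ≤ 1 + 2n₁ + k² + k. Eliminating p,
-- k² ≤ k + 2k n₁ + (4k+2)n₂. If n₁ = n₂ = 0 this says k ≤ 1, hence p ≤ 3; in general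
-- it says max(n₁, n₂) ≥ k/6 - O(1), and a small k makes n₁ large.
module Submission where

open import Defs
open import Data.Bool using (Bool; true; false; T; _∧_; not)
open import Data.Bool.ListAction using (any)
import Data.Bool.Properties as Bₚ
open import Data.Fin using (Fin; toℕ)
import Data.Fin as F
open import Data.Fin.Permutation using (permutation)
import Data.Fin.Properties as Fₚ
open import Data.Fin.Subset using (Subset; ∣_∣; _─_; _∈_)
open import Data.Fin.Subset.Properties using (_∈?_; drop-there; x∈p∧x∉q⇒x∈p─q)
import Data.Integer as ℤ
import Data.Integer.DivMod as ℤDM
import Data.Integer.Divisibility.Signed as ℤ∣
import Data.Integer.Properties as ℤₚ
open import Data.Integer.Tactic.RingSolver using (solve-∀)
open import Data.List using (allFin; map)
import Data.List as List
open import Data.List.Membership.Propositional using (lose)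
open import Data.List.Membership.Propositional.Properties using (∈-allFin)
open import Data.List.Relation.Unary.Any using (satisfied)
import Data.List.Relation.Unary.Any.Properties as Anyₚ
open import Data.Nat using (ℕ; NonZero; _>_; _⊔_)
import Data.Nat as ℕ
open import Data.Nat.Coprimality using (Coprime)
import Data.Nat.DivMod as DM
import Data.Nat.Divisibility as ℕ∣
open import Data.Nat.ListAction using () renaming (sum to sumList)
open import Data.Nat.Primality using (Prime; euclidsLemma; prime⇒nonTrivial)
import Data.Nat.Properties as ℕₚ
import Data.Nat.Tactic.RingSolver as ℕSolver
open import Data.Product using (_×_; Σ; ∃; _,_; proj₁; proj₂)
import Data.Rational.Properties as ℚₚ
import Data.Rational.Unnormalised as ℚᵘ
import Data.Rational.Unnormalised.Properties as ℚᵘₚ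
open import Data.Sum using (_⊎_; inj₁; inj₂; [_,_]′)
import Data.Sum as Sum
open import Data.Unit using (tt)
open import Data.Vec using ([]; _∷_; here; there)
open import Data.Vec.Properties using (lookup∘tabulate; []=⇒lookup; lookup⇒[]=)
open import Function.Base using (_∘_)
open import Function.Bundles using (_⇔_; mk⇔; Equivalence)
open import Relation.Binary.PropositionalEquality using (_≡_; _≢_; refl; sym; trans; cong; cong₂; subst; subst₂)
open import Relation.Nullary using (Dec; yes; no; ¬_; contradiction; toWitness; fromWitness; ⌊_⌋; _×-dec_)
open import Relation.Nullary.Decidable using (decidable-stable; map′)

-- Integer sums over `Fin n` and Iverson brackets.

module Sums where
  open import Algebra.Properties.Semiring.Sum ℤₚ.+-*-semiring public
    using (sum; ∑-distrib-+; ∑-comm; ∑-permute; *-distribˡ-sum; *-distribʳ-sum)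
    renaming (sum-cong-≗ to sum-cong)
  open ℤ hiding (suc; ∣_∣)
  open F using (zero; suc)

  private variable
    n : ℕ
    P Q : Set

  -- The Iverson bracket takes values in ℤ, so that counts can be subtracted and handed to the ring
  -- solver.
  [_] : Dec P → ℤ
  [ yes _ ] = 1ℤ
  [ no  _ ] = 0ℤ

  0≤[] : (d : Dec P) → 0ℤ ≤ [ d ]
  0≤[] (yes _) = +≤+ ℕ.z≤n
  0≤[] (no  _) = +≤+ ℕ.z≤n

  []-yes : (d : Dec P) → P → [ d ] ≡ 1ℤ
  []-yes (yes _) _ = refl
  []-yes (no ¬x) x = contradiction x ¬x

  []-no : (d : Dec P) → ¬ P → [ d ] ≡ 0ℤ
  []-no (yes x) ¬x = contradiction x ¬x
  []-no (no _)  _  = refl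

  []-mono : (d : Dec P) (e : Dec Q) → (P → Q) → [ d ] ≤ [ e ]
  []-mono (yes x) e f = ℤₚ.≤-reflexive (sym ([]-yes e (f x)))
  []-mono (no _)  e f = 0≤[] e

  []-cong : (d : Dec P) (e : Dec Q) → (P → Q) → (Q → P) → [ d ] ≡ [ e ]
  []-cong d e f g = ℤₚ.≤-antisym ([]-mono d e f) ([]-mono e d g)

  []-idem : (d : Dec P) → [ d ] * [ d ] ≡ [ d ]
  []-idem (yes _) = refl
  []-idem (no  _) = refl

  -- The comparison may assume `P`, so an estimate valid only on `A` can still be summed over all of
  -- `Fin p`.
  []*-mono : (d : Dec P) {i j : ℤ} → (P → i ≤ j) → [ d ] * i ≤ [ d ] * j
  []*-mono (yes x) {i} {j} i≤j rewrite ℤₚ.*-identityˡ i | ℤₚ.*-identityˡ j = i≤j x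
  []*-mono (no _)  {i} {j} i≤j rewrite ℤₚ.*-zeroˡ i | ℤₚ.*-zeroˡ j = ℤₚ.≤-refl

  []*-nonneg : (d : Dec P) {i : ℤ} → 0ℤ ≤ i → 0ℤ ≤ [ d ] * i
  []*-nonneg d {i} 0≤i = subst (_≤ [ d ] * i) (ℤₚ.*-zeroʳ [ d ]) ([]*-mono d (λ _ → 0≤i))

  []-× : (d : Dec P) (e : Dec Q) → [ d ] * [ e ] ≡ [ d ×-dec e ]
  []-× (yes _) (yes _) = refl
  []-× (yes _) (no _)  = refl
  []-× (no _)  (yes _) = refl
  []-× (no _)  (no _)  = refl

  sum-mono : {f g : Fin n → ℤ} → (∀ i → f i ≤ g i) → sum f ≤ sum g
  sum-mono {n = ℕ.zero}  _   = ℤₚ.≤-refl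
  sum-mono {n = ℕ.suc n} f≤g = ℤₚ.+-mono-≤ (f≤g zero) (sum-mono (f≤g ∘ suc))

  sum-const : ∀ n (c : ℤ) → sum {n} (λ _ → c) ≡ + n * c
  sum-const ℕ.zero    c = sym (ℤₚ.*-zeroˡ c)
  sum-const (ℕ.suc n) c = trans (cong (λ s → c + s) (sum-const n c)) (sym (ℤₚ.suc-* (+ n) c))

  sum-zero : {f : Fin n → ℤ} → (∀ i → f i ≡ 0ℤ) → sum f ≡ 0ℤ
  sum-zero {n = n} f≡0 = trans (sum-cong f≡0) (trans (sum-const n 0ℤ) (ℤₚ.*-zeroʳ (+ n)))

  sum-nonneg : {f : Fin n → ℤ} → (∀ i → 0ℤ ≤ f i) → 0ℤ ≤ sum f
  sum-nonneg {n = n} {f} 0≤f =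
    subst (_≤ sum f) (sum-zero {n = n} (λ _ → refl)) (sum-mono 0≤f)

  sum-point : (f : Fin n → ℤ) (i : Fin n) → sum (λ j → [ i F.≟ j ] * f j) ≡ f i
  sum-point f zero = trans (cong₂ _+_ (ℤₚ.*-identityˡ (f zero)) (sum-zero (λ j → ℤₚ.*-zeroˡ (f (suc j)))))
                           (ℤₚ.+-identityʳ (f zero))
  sum-point f (suc i) = trans (cong₂ _+_ (ℤₚ.*-zeroˡ (f zero)) (trans (sum-cong step) (sum-point (f ∘ suc) i)))
                              (ℤₚ.+-identityˡ (f (suc i)))
    where
    step : ∀ j → [ suc i F.≟ suc j ] * f (suc j) ≡ [ i F.≟ j ] * f (suc j)
    step j = cong (_* f (suc j)) ([]-cong (suc i F.≟ suc j) (i F.≟ j) Fₚ.suc-injective (cong suc))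

  sum-unique : {P : Fin n → Set} (P? : ∀ i → Dec (P i)) (g : Fin n → ℤ) {i : Fin n} →
               P i → (∀ j → P j → i ≡ j) → sum (λ j → [ P? j ] * g j) ≡ g i
  sum-unique P? g {i} Pi uniq = trans (sum-cong step) (sum-point g i)
    where
    step : ∀ j → [ P? j ] * g j ≡ [ i F.≟ j ] * g j
    step j = cong (_* g j) ([]-cong (P? j) (i F.≟ j) (uniq j) (λ { refl → Pi }))

  count-unique : {P : Fin n → Set} (P? : ∀ i → Dec (P i)) {i : Fin n} →
                 P i → (∀ j → P j → i ≡ j) → sum (λ j → [ P? j ]) ≡ 1ℤ
  count-unique P? Pi uniq =
    trans (sum-cong (λ j → sym (ℤₚ.*-identityʳ [ P? j ]))) (sum-unique P? (λ _ → 1ℤ) Pi uniq)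

  -- Either no index satisfies `P` and the sum vanishes, or one does, which yields `Q` and makes the
  -- count exactly one. It serves whenever an equation determines its unknown.
  count-subsingleton : {P : Fin n → Set} (P? : ∀ i → Dec (P i)) (d : Dec Q) →
                       (∀ i → P i → Q) → (∀ i j → P i → P j → i ≡ j) → sum (λ j → [ P? j ]) ≤ [ d ]
  count-subsingleton P? d P⇒Q uniq with Fₚ.any? P?
  ... | yes (i , Pi) = ℤₚ.≤-reflexive (trans (count-unique P? Pi (λ j → uniq i j Pi)) (sym ([]-yes d (P⇒Q i Pi))))
  ... | no ¬∃ = subst (_≤ [ d ]) (sym (sum-zero (λ i → []-no (P? i) (λ Pi → ¬∃ (i , Pi))))) (0≤[] d)

  term≤sum : {f : Fin n → ℤ} → (∀ i → 0ℤ ≤ f i) → ∀ i → f i ≤ sum f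
  term≤sum {f = f} 0≤f i = subst (_≤ sum f) (sum-point f i) (sum-mono step)
    where
    step : ∀ j → [ i F.≟ j ] * f j ≤ f j
    step j with i F.≟ j
    ... | yes _ = ℤₚ.≤-reflexive (ℤₚ.*-identityˡ (f j))
    ... | no _  = subst (_≤ f j) (sym (ℤₚ.*-zeroˡ (f j))) (0≤f j)

  -- The point masses at `i` and `j` never overlap. This will count the two roots of a square and
  -- the two orders of a sum.
  two-terms≤sum : {f : Fin n → ℤ} → (∀ i → 0ℤ ≤ f i) → ∀ {i j} → i ≢ j → f i + f j ≤ sum f
  two-terms≤sum {f = f} 0≤f {i} {j} i≢j =
    subst (_≤ sum f) (trans (∑-distrib-+ (λ k → [ i F.≟ k ] * f k) (λ k → [ j F.≟ k ] * f k)) (cong₂ _+_ (sum-point f i) (sum-point f j))) (sum-mono step)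
    where
    step : ∀ k → [ i F.≟ k ] * f k + [ j F.≟ k ] * f k ≤ f k
    step k with i F.≟ k | j F.≟ k
    ... | yes i≡k | yes j≡k = contradiction (trans i≡k (sym j≡k)) i≢j
    ... | yes _   | no _    = ℤₚ.≤-reflexive (1x+0x (f k))
      where 1x+0x : ∀ x → 1ℤ * x + 0ℤ * x ≡ x
            1x+0x = solve-∀
    ... | no _    | yes _   = ℤₚ.≤-reflexive (0x+1x (f k))
      where 0x+1x : ∀ x → 0ℤ * x + 1ℤ * x ≡ x
            0x+1x = solve-∀
    ... | no _    | no _    = subst (_≤ f k) (sym (0x+0x (f k))) (0≤f k)
      where 0x+0x : ∀ x → 0ℤ * x + 0ℤ * x ≡ 0ℤ
            0x+0x = solve-∀

  sum-* : ∀ {m} (f : Fin n → ℤ) (g : Fin m → ℤ) → sum f * sum g ≡ sum (λ i → sum (λ j → f i * g j))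
  sum-* f g = trans (*-distribʳ-sum (sum g) f) (sum-cong (λ i → *-distribˡ-sum (f i) g))

  sum-minus : (f g : Fin n → ℤ) → sum (λ i → f i - g i) ≡ sum f - sum g
  sum-minus f g = trans (∑-distrib-+ f (λ i → - g i)) (cong (λ s → sum f + s) sum-neg)
    where
    sum-neg : sum (λ i → - g i) ≡ - sum g
    sum-neg = trans (sum-cong (λ i → sym (ℤₚ.-1*i≡-i (g i)))) (trans (sym (*-distribˡ-sum -1ℤ g)) (ℤₚ.-1*i≡-i (sum g)))

-- Congruences modulo p and their canonical representatives.

module Residues (p : ℕ) .{{_ : NonZero p}} where
  open ℤ hiding (suc; ∣_∣; NonZero; _⊖_)
  open ℤ∣ using (_∣_; divides)

  ⟦_⟧ : Fin p → ℤ
  ⟦ x ⟧ = + toℕ x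

  infix 4 _≋_ _≋?_
  -- A record rather than a synonym for divisibility, so that `i` and `j` can be inferred from the
  -- type; the difference `i - j` would not determine them.
  record _≋_ (i j : ℤ) : Set where
    constructor mk≋
    field p∣i-j : + p ∣ i - j

  _≋?_ : ∀ i j → Dec (i ≋ j)
  i ≋? j = map′ mk≋ _≋_.p∣i-j (+ p ℤ∣.∣? (i - j))

  ≋-refl : ∀ {i} → i ≋ i
  ≋-refl {i} = mk≋ (divides 0ℤ (trans (ℤₚ.+-inverseʳ i) (sym (ℤₚ.*-zeroˡ (+ p)))))

  ≋-reflexive : ∀ {i j} → i ≡ j → i ≋ j
  ≋-reflexive refl = ≋-refl

  ≋-sym : ∀ {i j} → i ≋ j → j ≋ i
  ≋-sym {i} {j} (mk≋ d) = mk≋ (subst (+ p ∣_) (eq i j) (ℤ∣.∣m⇒∣-m d))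
    where
    eq : ∀ i j → - (i - j) ≡ j - i
    eq = solve-∀

  ≋-trans : ∀ {i j k} → i ≋ j → j ≋ k → i ≋ k
  ≋-trans {i} {j} {k} (mk≋ d) (mk≋ e) = mk≋ (subst (+ p ∣_) (eq i j k) (ℤ∣.∣m∣n⇒∣m+n d e))
    where
    eq : ∀ i j k → (i - j) + (j - k) ≡ i - k
    eq = solve-∀

  +-cong-≋ : ∀ {i j k l} → i ≋ j → k ≋ l → i + k ≋ j + l
  +-cong-≋ {i} {j} {k} {l} (mk≋ d) (mk≋ e) = mk≋ (subst (+ p ∣_) (eq i j k l) (ℤ∣.∣m∣n⇒∣m+n d e))
    where
    eq : ∀ i j k l → (i - j) + (k - l) ≡ (i + k) - (j + l)
    eq = solve-∀

  neg-cong-≋ : ∀ {i j} → i ≋ j → - i ≋ - j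
  neg-cong-≋ {i} {j} (mk≋ d) = mk≋ (subst (+ p ∣_) (eq i j) (ℤ∣.∣m⇒∣-m d))
    where
    eq : ∀ i j → - (i - j) ≡ - i - - j
    eq = solve-∀

  *-cong-≋ : ∀ {i j k l} → i ≋ j → k ≋ l → i * k ≋ j * l
  *-cong-≋ {i} {j} {k} {l} (mk≋ d) (mk≋ e) =
    mk≋ (subst (+ p ∣_) (eq i j k l) (ℤ∣.∣m∣n⇒∣m+n (ℤ∣.∣m⇒∣m*n k d) (ℤ∣.∣n⇒∣m*n j e)))
    where
    eq : ∀ i j k l → (i - j) * k + j * (k - l) ≡ i * k - j * l
    eq = solve-∀

  residue : ℤ → Fin p
  residue i = F.fromℕ< (ℤDM.n%ℕd<d i p)

  ⟦residue⟧ : ∀ i → ⟦ residue i ⟧ ≋ i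
  ⟦residue⟧ i = ≋-sym (mk≋ (divides (i /ℕ p) (trans (cong (λ j → j - ⟦ residue i ⟧) eq) (cancel ⟦ residue i ⟧ _))))
    where
    eq : i ≡ ⟦ residue i ⟧ + (i /ℕ p) * + p
    eq = trans (ℤDM.a≡a%ℕn+[a/ℕn]*n i p)
               (cong (λ r → + r + (i /ℕ p) * + p) (sym (Fₚ.toℕ-fromℕ< (ℤDM.n%ℕd<d i p))))
    cancel : ∀ r q → r + q - r ≡ q
    cancel = solve-∀

  -- Both representatives lie below p, so their difference is a multiple of p smaller than p, hence
  -- zero.
  ≋⇒≡ : ∀ {x y} → ⟦ x ⟧ ≋ ⟦ y ⟧ → x ≡ y
  ≋⇒≡ {x} {y} d = Fₚ.toℕ-injective ([ le x y d , sym ∘ le y x (≋-sym d) ]′ (ℕₚ.≤-total (toℕ y) (toℕ x)))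
    where
    le : ∀ x y → ⟦ x ⟧ ≋ ⟦ y ⟧ → toℕ y ℕ.≤ toℕ x → toℕ x ≡ toℕ y
    le x y (mk≋ d) y≤x = trans (sym (ℕₚ.m∸n+n≡m y≤x)) (cong (ℕ._+ toℕ y) diff≡0)
      where
      p∣diff : p ℕ∣.∣ toℕ x ℕ.∸ toℕ y
      p∣diff = subst (λ i → p ℕ∣.∣ ℤ.∣ i ∣) (trans (ℤₚ.m-n≡m⊖n (toℕ x) (toℕ y)) (ℤₚ.⊖-≥ y≤x)) (ℤ∣.∣⇒∣ᵤ d)
      diff≡0 : toℕ x ℕ.∸ toℕ y ≡ 0
      diff≡0 with toℕ x ℕ.∸ toℕ y in eq
      ... | ℕ.zero  = refl
      ... | ℕ.suc _ = contradiction
        (ℕₚ.≤-trans (ℕ∣.∣⇒≤ (subst (p ℕ∣.∣_) eq p∣diff)) (ℕₚ.≤-reflexive (sym eq)))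
        (ℕₚ.<⇒≱ (ℕₚ.≤-<-trans (ℕₚ.m∸n≤m (toℕ x) (toℕ y)) (Fₚ.toℕ<n x)))

  ⟦mod⟧ : ∀ m → ⟦ m DM.mod p ⟧ ≋ + m
  ⟦mod⟧ m = ⟦residue⟧ (+ m)

  ⟦⊕⟧ : ∀ x y → ⟦ x ⊕ y ⟧ ≋ ⟦ x ⟧ + ⟦ y ⟧
  ⟦⊕⟧ x y = ⟦mod⟧ (toℕ x ℕ.+ toℕ y)

  ⟦⊗⟧ : ∀ x y → ⟦ x ⊗ y ⟧ ≋ ⟦ x ⟧ * ⟦ y ⟧
  ⟦⊗⟧ x y = subst (λ i → ⟦ x ⊗ y ⟧ ≋ i) (ℤₚ.pos-* (toℕ x) (toℕ y)) (⟦mod⟧ (toℕ x ℕ.* toℕ y))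

  infixl 6 _⊖_
  _⊖_ : Fin p → Fin p → Fin p
  x ⊖ y = residue (⟦ x ⟧ - ⟦ y ⟧)

  ⊖-⊕ : ∀ x y → (x ⊖ y) ⊕ y ≡ x
  ⊖-⊕ x y = ≋⇒≡ (≋-trans (⟦⊕⟧ (x ⊖ y) y) (subst (λ i → ⟦ x ⊖ y ⟧ + ⟦ y ⟧ ≋ i) (eq ⟦ x ⟧ ⟦ y ⟧)
    (+-cong-≋ (⟦residue⟧ (⟦ x ⟧ - ⟦ y ⟧)) (≋-refl {⟦ y ⟧}))))
    where
    eq : ∀ x y → (x - y) + y ≡ x
    eq = solve-∀

  ⊕-⊖ : ∀ x y → (x ⊕ y) ⊖ y ≡ x
  ⊕-⊖ x y = ≋⇒≡ (≋-trans (⟦residue⟧ _) (subst (λ i → ⟦ x ⊕ y ⟧ - ⟦ y ⟧ ≋ i) (eq ⟦ x ⟧ ⟦ y ⟧)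
    (+-cong-≋ (⟦⊕⟧ x y) (≋-refl { - ⟦ y ⟧}))))
    where
    eq : ∀ x y → (x + y) - y ≡ x
    eq = solve-∀

  ⊕-cancelʳ : ∀ {x y} z → x ⊕ z ≡ y ⊕ z → x ≡ y
  ⊕-cancelʳ {x} {y} z eq = trans (sym (⊕-⊖ x z)) (trans (cong (_⊖ z) eq) (⊕-⊖ y z))

  ⊕-comm : ∀ x y → x ⊕ y ≡ y ⊕ x
  ⊕-comm x y = cong (DM._mod p) (ℕₚ.+-comm (toℕ x) (toℕ y))

  ≋0⇒∣ : ∀ {i} → i ≋ 0ℤ → p ℕ∣.∣ ℤ.∣ i ∣
  ≋0⇒∣ {i} (mk≋ d) = ℤ∣.∣⇒∣ᵤ (subst (+ p ∣_) (ℤₚ.+-identityʳ i) d)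

  module _ (prime : Prime p) where
    -- Euclid's lemma applied to absolute values: there are no zero divisors modulo p.
    ≋0-* : ∀ {i j} → i * j ≋ 0ℤ → i ≋ 0ℤ ⊎ j ≋ 0ℤ
    ≋0-* {i} {j} d = Sum.map from from
      (euclidsLemma ℤ.∣ i ∣ ℤ.∣ j ∣ prime (subst (p ℕ∣.∣_) (ℤₚ.abs-* i j) (≋0⇒∣ d)))
      where
      from : ∀ {i} → p ℕ∣.∣ ℤ.∣ i ∣ → i ≋ 0ℤ
      from {i} d = mk≋ (subst (+ p ∣_) (sym (ℤₚ.+-identityʳ i)) (ℤ∣.∣ᵤ⇒∣ d))

-- Boolean tests as propositions.

any-allFin : ∀ {n} (f : Fin n → Bool) → T (any f (allFin n)) ⇔ ∃ (T ∘ f)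
any-allFin {n} f = mk⇔ (satisfied ∘ Anyₚ.any⁻ f (allFin n)) (λ { (x , fx) → Anyₚ.any⁺ {xs = allFin n} f (lose (∈-allFin x) fx) })

T-mem : ∀ {n} .{{_ : NonZero n}} {x : Fin n} {A : Subset n} → T (mem x A) ⇔ (x ∈ A)
T-mem {x = x} {A} = mk⇔ (lookup⇒[]= x A ∘ Equivalence.to Bₚ.T-≡) (Equivalence.from Bₚ.T-≡ ∘ []=⇒lookup)

-- Square roots modulo an odd prime and their correlations.

module Squares (p : ℕ) .{{_ : NonZero p}} (prime : Prime p) (2<p : 2 ℕ.< p) where
  open Sums
  open Residues p
  open ℤ hiding (suc; ∣_∣; NonZero; _⊖_)

  2≄0 : ¬ + 2 ≋ 0ℤ
  2≄0 2≋0 = ℕₚ.<⇒≱ 2<p (ℕ∣.∣⇒≤ (≋0⇒∣ 2≋0))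

  toℕ≡0⇒≋0 : ∀ {x} → toℕ x ≡ 0 → ⟦ x ⟧ ≋ 0ℤ
  toℕ≡0⇒≋0 eq = ≋-reflexive (cong +_ eq)

  ≋0⇒toℕ≡0 : ∀ {x} → ⟦ x ⟧ ≋ 0ℤ → toℕ x ≡ 0
  ≋0⇒toℕ≡0 {x} d with toℕ x | ≋0⇒∣ d | Fₚ.toℕ<n x
  ... | ℕ.zero  | _   | _   = refl
  ... | ℕ.suc _ | p∣x | x<p = contradiction (ℕ∣.∣⇒≤ p∣x) (ℕₚ.<⇒≱ x<p)

  ∈QR : ∀ {x} → x ∈ QR ⇔ (¬ ⟦ x ⟧ ≋ 0ℤ × ∃ λ y → y ⊗ y ≡ x)
  ∈QR {x} = mk⇔ to from
    where
    Tmem≡ : mem x QR ≡ (not ⌊ toℕ x ℕ.≟ 0 ⌋ ∧ any (λ y → ⌊ (y ⊗ y) F.≟ x ⌋) (allFin p))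
    Tmem≡ = lookup∘tabulate _ x
    to : x ∈ QR → ¬ ⟦ x ⟧ ≋ 0ℤ × ∃ λ y → y ⊗ y ≡ x
    to x∈ = (λ x≋0 → T-not (≋0⇒toℕ≡0 x≋0) (proj₁ both)) , proj₁ w , toWitness (proj₂ w)
      where
      both = Equivalence.to Bₚ.T-∧ (subst T Tmem≡ (Equivalence.from T-mem x∈))
      w = Equivalence.to (any-allFin _) (proj₂ both)
      T-not : toℕ x ≡ 0 → ¬ T (not ⌊ toℕ x ℕ.≟ 0 ⌋)
      T-not eq rewrite eq = λ ()
    from : ¬ ⟦ x ⟧ ≋ 0ℤ × ∃ (λ y → y ⊗ y ≡ x) → x ∈ QR
    from (x≄0 , y , eq) = Equivalence.to T-mem (subst T (sym Tmem≡)
      (Equivalence.from Bₚ.T-∧ (nonzero , Equivalence.from (any-allFin _) (y , fromWitness eq))))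
      where
      nonzero : T (not ⌊ toℕ x ℕ.≟ 0 ⌋)
      nonzero with toℕ x ℕ.≟ 0
      ... | yes x≡0 = contradiction (toℕ≡0⇒≋0 x≡0) x≄0
      ... | no _    = tt

  -- Translation by `a` permutes `Fin p`, with inverse `_⊖ a`.
  sum-shift : (g : Fin p → ℤ) (a : Fin p) → sum (λ x → g (x ⊕ a)) ≡ sum g
  sum-shift g a = sym (∑-permute g (permutation (_⊕ a) (_⊖ a) (λ x → ⊖-⊕ x a) (λ x → ⊕-⊖ x a)))

  -- This is 1 + χ(x) for the quadratic character χ. Counting roots makes character sums into counts
  -- of solutions, with no appeal to the multiplicativity of χ.
  roots : Fin p → ℤ
  roots x = sum (λ y → [ y ⊗ y F.≟ x ])

  -- Double counting: every `y` is a root of exactly one `x`.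
  sum-roots : sum roots ≡ + p
  sum-roots = trans (∑-comm (λ x y → [ y ⊗ y F.≟ x ]))
    (trans (sum-cong (λ y → count-unique (λ x → y ⊗ y F.≟ x) refl (λ _ eq → eq)))
      (trans (sum-const p 1ℤ) (ℤₚ.*-identityʳ (+ p))))

  opp : Fin p → Fin p
  opp x = residue (- ⟦ x ⟧)

  opp-⊗ : ∀ x → opp x ⊗ opp x ≡ x ⊗ x
  opp-⊗ x = ≋⇒≡ (≋-trans (⟦⊗⟧ (opp x) (opp x)) (≋-trans (*-cong-≋ (⟦residue⟧ (- ⟦ x ⟧)) (⟦residue⟧ (- ⟦ x ⟧)))
    (≋-trans (≋-reflexive (eq ⟦ x ⟧)) (≋-sym (⟦⊗⟧ x x)))))
    where
    eq : ∀ x → - x * - x ≡ x * x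
    eq = solve-∀

  ⟦⊗⟧≡ : ∀ x {y} → x ⊗ x ≡ y → ⟦ x ⟧ * ⟦ x ⟧ ≋ ⟦ y ⟧
  ⟦⊗⟧≡ x refl = ≋-sym (⟦⊗⟧ x x)

  ≋-shift : ∀ {i j} → i ≋ j → i - j ≋ 0ℤ
  ≋-shift {i} {j} d = subst (λ k → i - j ≋ k) (ℤₚ.+-inverseʳ j) (+-cong-≋ d ≋-refl)

  ≋-unshift : ∀ {i j} → i - j ≋ 0ℤ → i ≋ j
  ≋-unshift {i} {j} d = subst₂ _≋_ (eq i j) (ℤₚ.+-identityˡ j) (+-cong-≋ d (≋-refl {j}))
    where
    eq : ∀ i j → i - j + j ≡ i
    eq = solve-∀

  -- The factorisation x² - y² = (x - y)(x + y) together with `≋0-*`.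
  ⊗-square-roots : ∀ x y → x ⊗ x ≡ y ⊗ y → y ≡ x ⊎ opp y ≡ x
  ⊗-square-roots x y eq = [ inj₁ ∘ sym ∘ ≋⇒≡ ∘ ≋-unshift , inj₂ ∘ sum≋0 ]′ (≋0-* prime product)
    where
    factor : ∀ x y → x * x - y * y ≡ (x - y) * (x + y)
    factor = solve-∀
    product : (⟦ x ⟧ - ⟦ y ⟧) * (⟦ x ⟧ + ⟦ y ⟧) ≋ 0ℤ
    product = subst (_≋ 0ℤ) (factor ⟦ x ⟧ ⟦ y ⟧) (≋-shift (≋-trans (⟦⊗⟧≡ x eq) (⟦⊗⟧ y y)))
    neg-neg : ∀ x y → x + y ≡ x - (- y)
    neg-neg = solve-∀
    sum≋0 : ⟦ x ⟧ + ⟦ y ⟧ ≋ 0ℤ → opp y ≡ x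
    sum≋0 d = ≋⇒≡ (≋-trans (⟦residue⟧ (- ⟦ y ⟧)) (≋-sym (≋-unshift {⟦ x ⟧} { - ⟦ y ⟧} (subst (_≋ 0ℤ) (neg-neg ⟦ x ⟧ ⟦ y ⟧) d))))

  -- If -y = y then 2y = 0, and 2 is invertible because p is odd.
  opp≢ : ∀ {y} → ¬ ⟦ y ⟧ ≋ 0ℤ → opp y ≢ y
  opp≢ {y} y≄0 eq = [ 2≄0 , y≄0 ]′ (≋0-* prime (subst (_≋ 0ℤ) (double ⟦ y ⟧) (≋-shift {⟦ y ⟧} { - ⟦ y ⟧} y≋-y)))
    where
    double : ∀ y → y - - y ≡ + 2 * y
    double = solve-∀
    y≋-y : ⟦ y ⟧ ≋ - ⟦ y ⟧
    y≋-y = subst (λ z → ⟦ z ⟧ ≋ - ⟦ y ⟧) eq (⟦residue⟧ (- ⟦ y ⟧))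

  square≋0 : ∀ {x} y → y ⊗ y ≡ x → ⟦ y ⟧ ≋ 0ℤ → ⟦ x ⟧ ≋ 0ℤ
  square≋0 y eq d = ≋-trans (≋-sym (⟦⊗⟧≡ y eq)) (*-cong-≋ d d)

  -- A nonzero square y² has the second root -y, distinct from y.
  roots≥ : ∀ x → + 2 * [ x ∈? QR ] ≤ roots x
  roots≥ x = cases (x ∈? QR)
    where
    nonneg : ∀ y → 0ℤ ≤ [ y ⊗ y F.≟ x ]
    nonneg y = 0≤[] (y ⊗ y F.≟ x)
    two : (¬ ⟦ x ⟧ ≋ 0ℤ × ∃ λ y → y ⊗ y ≡ x) → + 2 ≤ roots x
    two (x≄0 , y , eq) = subst (_≤ roots x)
      (cong₂ _+_ ([]-yes (opp y ⊗ opp y F.≟ x) (trans (opp-⊗ y) eq)) ([]-yes (y ⊗ y F.≟ x) eq))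
      (two-terms≤sum {f = λ z → [ z ⊗ z F.≟ x ]} nonneg {opp y} {y} (opp≢ (x≄0 ∘ square≋0 y eq)))
    cases : (d : Dec (x ∈ QR)) → + 2 * [ d ] ≤ roots x
    cases (no _)   = sum-nonneg nonneg
    cases (yes x∈) = two (Equivalence.to ∈QR x∈)

  zero₀ : Fin p
  zero₀ = residue 0ℤ

  zero₀≡ : ∀ {x} → ⟦ x ⟧ ≋ 0ℤ → zero₀ ≡ x
  zero₀≡ d = ≋⇒≡ (≋-trans (⟦residue⟧ 0ℤ) (≋-sym d))

  -- A square y² has no roots besides y and -y. Outside `QR` only x = 0 has a root, namely 0, and
  -- the first bracket accounts for it.
  roots≤ : ∀ x → roots x ≤ [ zero₀ F.≟ x ] + + 2 * [ x ∈? QR ]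
  roots≤ x = cases (x ∈? QR)
    where
    two : (∃ λ y → y ⊗ y ≡ x) → roots x ≤ + 2
    two (y , eq) = subst (roots x ≤_) total
      (sum-mono {f = λ z → [ z ⊗ z F.≟ x ]} {g = λ z → [ y F.≟ z ] + [ opp y F.≟ z ]} (λ z → le z (z ⊗ z F.≟ x)))
      where
      total : sum (λ z → [ y F.≟ z ] + [ opp y F.≟ z ]) ≡ + 2
      total = trans (∑-distrib-+ (λ z → [ y F.≟ z ]) (λ z → [ opp y F.≟ z ]))
        (cong₂ _+_ (count-unique (y F.≟_) refl (λ _ eq → eq)) (count-unique (opp y F.≟_) refl (λ _ eq → eq)))
      le : ∀ z (d : Dec (z ⊗ z ≡ x)) → [ d ] ≤ [ y F.≟ z ] + [ opp y F.≟ z ]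
      le z (no _)   = ℤₚ.+-mono-≤ (0≤[] (y F.≟ z)) (0≤[] (opp y F.≟ z))
      le z (yes zz) =
        [ (λ y≡z → ℤₚ.+-mono-≤ (ℤₚ.≤-reflexive (sym ([]-yes (y F.≟ z) y≡z))) (0≤[] (opp y F.≟ z)))
        , (λ o≡z → ℤₚ.+-mono-≤ (0≤[] (y F.≟ z)) (ℤₚ.≤-reflexive (sym ([]-yes (opp y F.≟ z) o≡z))))
        ]′ (⊗-square-roots z y (trans zz (sym eq)))
    -- Were x nonzero, the root y would put it in `QR`; congruence is decidable, so the double
    -- negation can be removed.
    root≋0 : ¬ x ∈ QR → ∀ y → y ⊗ y ≡ x → ⟦ x ⟧ ≋ 0ℤ
    root≋0 x∉ y eq = decidable-stable (⟦ x ⟧ ≋? 0ℤ) (λ x≄0 → x∉ (Equivalence.from ∈QR (x≄0 , y , eq)))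
    zero-root : ¬ x ∈ QR → ∀ y → y ⊗ y ≡ x → zero₀ ≡ y
    zero-root x∉ y eq =
      zero₀≡ ([ (λ d → d) , (λ d → d) ]′ (≋0-* prime (≋-trans (⟦⊗⟧≡ y eq) (root≋0 x∉ y eq))))
    cases : (d : Dec (x ∈ QR)) → roots x ≤ [ zero₀ F.≟ x ] + + 2 * [ d ]
    cases (yes x∈) = ℤₚ.≤-trans (two (proj₂ (Equivalence.to ∈QR x∈))) (ℤₚ.+-monoˡ-≤ (+ 2) (0≤[] (zero₀ F.≟ x)))
    cases (no x∉) = subst (roots x ≤_) (sym (ℤₚ.+-identityʳ [ zero₀ F.≟ x ]))
      (count-subsingleton (λ y → y ⊗ y F.≟ x) (zero₀ F.≟ x)
        (λ y eq → zero₀≡ (root≋0 x∉ y eq))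
        (λ y z eq eq′ → trans (sym (zero-root x∉ y eq)) (zero-root x∉ z eq′)))

  -- Sum `roots≤` over all x and compare with `sum-roots`.
  p≤1+2∣QR∣ : + p ≤ 1ℤ + + 2 * sum (λ x → [ x ∈? QR ])
  p≤1+2∣QR∣ = subst₂ _≤_ sum-roots
    (trans (∑-distrib-+ (λ x → [ zero₀ F.≟ x ]) (λ x → + 2 * [ x ∈? QR ]))
      (cong₂ _+_ (count-unique (zero₀ F.≟_) refl (λ _ eq → eq)) (sym (*-distribˡ-sum (+ 2) (λ x → [ x ∈? QR ])))))
    (sum-mono {p} roots≤)

  -- Writing y = u + z in y² = x + a, z² = x + b gives u (2z + u) = a - b, which
  -- determines z unless u = 0.
  correlation : ∀ a b → sum (λ x → roots (x ⊕ a) * roots (x ⊕ b)) ≤ + p + (+ p * [ a F.≟ b ] - 1ℤ)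
  correlation a b = begin
    sum (λ x → roots (x ⊕ a) * roots (x ⊕ b))
      ≡⟨ sum-cong (λ x → sum-* (λ y → [ y ⊗ y F.≟ x ⊕ a ]) (λ z → [ z ⊗ z F.≟ x ⊕ b ])) ⟩
    sum (λ x → sum (λ y → sum (λ z → G x y z)))
      ≡⟨ ∑-comm (λ x y → sum (λ z → G x y z)) ⟩
    sum (λ y → sum (λ x → sum (λ z → G x y z)))
      ≡⟨ sum-cong (λ y → ∑-comm (λ x z → G x y z)) ⟩
    sum (λ y → sum (λ z → sum (λ x → G x y z)))
      ≡⟨ ∑-comm (λ y z → sum (λ x → G x y z)) ⟩
    sum (λ z → sum (λ y → sum (λ x → G x y z)))
      ≡⟨ sum-cong (λ z → sym (sum-shift (λ y → sum (λ x → G x y z)) z)) ⟩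
    sum (λ z → sum (λ u → sum (λ x → G x (u ⊕ z) z)))
      ≡⟨ ∑-comm (λ z u → sum (λ x → G x (u ⊕ z) z)) ⟩
    sum (λ u → sum (λ z → sum (λ x → G x (u ⊕ z) z)))
      ≤⟨ sum-mono {p} (λ u → sum-mono {p} (λ z → inner u z)) ⟩
    sum (λ u → sum (λ z → [ D u z ]))
      ≤⟨ sum-mono {p} middle ⟩
    sum (λ u → 1ℤ + [ zero₀ F.≟ u ] * (+ p * [ a F.≟ b ] - 1ℤ))
      ≡⟨ ∑-distrib-+ (λ _ → 1ℤ) (λ u → [ zero₀ F.≟ u ] * (+ p * [ a F.≟ b ] - 1ℤ)) ⟩
    sum {p} (λ _ → 1ℤ) + sum (λ u → [ zero₀ F.≟ u ] * (+ p * [ a F.≟ b ] - 1ℤ))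
      ≡⟨ cong₂ _+_ (trans (sum-const p 1ℤ) (ℤₚ.*-identityʳ (+ p))) (sum-point _ zero₀) ⟩
    + p + (+ p * [ a F.≟ b ] - 1ℤ) ∎
    where
    open ℤₚ.≤-Reasoning
    G : Fin p → Fin p → Fin p → ℤ
    G x y z = [ y ⊗ y F.≟ x ⊕ a ] * [ z ⊗ z F.≟ x ⊕ b ]

    D : ∀ u z → Dec (⟦ u ⟧ * (+ 2 * ⟦ z ⟧ + ⟦ u ⟧) ≋ ⟦ a ⟧ - ⟦ b ⟧)
    D u z = ⟦ u ⟧ * (+ 2 * ⟦ z ⟧ + ⟦ u ⟧) ≋? ⟦ a ⟧ - ⟦ b ⟧

    -- The equation z² = x + b fixes x, so at most one x contributes; subtracting the two equations
    -- gives the condition decided by `D u z`.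
    inner : ∀ u z → sum (λ x → G x (u ⊕ z) z) ≤ [ D u z ]
    inner u z = subst (_≤ [ D u z ]) (sum-cong (λ x → sym ([]-× (E x) (E′ x))))
      (count-subsingleton (λ x → E x ×-dec E′ x) (D u z) diff (λ x x′ e e′ → ⊕-cancelʳ b (trans (sym (proj₂ e)) (proj₂ e′))))
      where
      E : ∀ x → Dec ((u ⊕ z) ⊗ (u ⊕ z) ≡ x ⊕ a)
      E x = (u ⊕ z) ⊗ (u ⊕ z) F.≟ x ⊕ a
      E′ : ∀ x → Dec (z ⊗ z ≡ x ⊕ b)
      E′ x = z ⊗ z F.≟ x ⊕ b
      lhs : ∀ u z → (u + z) * (u + z) + - (z * z) ≡ u * (+ 2 * z + u)
      lhs = solve-∀
      rhs : ∀ x a b → x + a + - (x + b) ≡ a - b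
      rhs = solve-∀
      diff : ∀ x → (u ⊕ z) ⊗ (u ⊕ z) ≡ x ⊕ a × z ⊗ z ≡ x ⊕ b → ⟦ u ⟧ * (+ 2 * ⟦ z ⟧ + ⟦ u ⟧) ≋ ⟦ a ⟧ - ⟦ b ⟧
      diff x (e , e′) = subst₂ _≋_ (lhs ⟦ u ⟧ ⟦ z ⟧) (rhs ⟦ x ⟧ ⟦ a ⟧ ⟦ b ⟧)
        (+-cong-≋ (≋-trans (*-cong-≋ (≋-sym (⟦⊕⟧ u z)) (≋-sym (⟦⊕⟧ u z))) (≋-trans (⟦⊗⟧≡ (u ⊕ z) e) (⟦⊕⟧ x a)))
                  (neg-cong-≋ (≋-trans (⟦⊗⟧≡ z e′) (⟦⊕⟧ x b))))

    middle : ∀ u → sum (λ z → [ D u z ]) ≤ 1ℤ + [ zero₀ F.≟ u ] * (+ p * [ a F.≟ b ] - 1ℤ)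
    middle u with zero₀ F.≟ u
    ... | no u≢0 = count-subsingleton (D u) (yes tt) (λ _ _ → tt) injective
      where
      u≄0 : ¬ ⟦ u ⟧ ≋ 0ℤ
      u≄0 d = u≢0 (≋⇒≡ (≋-trans (⟦residue⟧ 0ℤ) (≋-sym d)))
      factor : ∀ u z w → u * (+ 2 * z + u) - u * (+ 2 * w + u) ≡ u * (+ 2 * (z - w))
      factor = solve-∀
      injective : ∀ z w → ⟦ u ⟧ * (+ 2 * ⟦ z ⟧ + ⟦ u ⟧) ≋ ⟦ a ⟧ - ⟦ b ⟧ → ⟦ u ⟧ * (+ 2 * ⟦ w ⟧ + ⟦ u ⟧) ≋ ⟦ a ⟧ - ⟦ b ⟧ → z ≡ w
      injective z w d e =
        [ (λ u≋0 → contradiction u≋0 u≄0)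
        , [ (λ 2≋0 → contradiction 2≋0 2≄0) , ≋⇒≡ ∘ ≋-unshift ]′ ∘ ≋0-* prime {+ 2} {⟦ z ⟧ - ⟦ w ⟧}
        ]′ (≋0-* prime {⟦ u ⟧} {+ 2 * (⟦ z ⟧ - ⟦ w ⟧)} (subst (_≋ 0ℤ) (factor ⟦ u ⟧ ⟦ z ⟧ ⟦ w ⟧) (≋-shift (≋-trans d (≋-sym e)))))
    -- At u = 0 the condition reads a = b for every z, contributing at most p[a = b]. It is written
    -- as 1 plus a correction to match the bound 1 at the other u.
    ... | yes refl = subst (sum (λ z → [ D zero₀ z ]) ≤_) (trans (sum-const p [ a F.≟ b ]) (rearrange (+ p * [ a F.≟ b ])))
      (sum-mono {p} (λ z → []-mono (D zero₀ z) (a F.≟ b) (λ d → ≋⇒≡ (≋-unshift (≋-sym (≋-trans (≋-sym (*-cong-≋ (⟦residue⟧ 0ℤ) ≋-refl)) d))))))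
      where
      rearrange : ∀ c → c ≡ 1ℤ + 1ℤ * (c - 1ℤ)
      rearrange = solve-∀

-- Cardinalities, list sums and Booleans as integer sums.

module SubsetSums where
  open Sums
  open ℤ hiding (suc; ∣_∣; NonZero; _⊖_)

  private variable
    n : ℕ

  ∣∣≡sum : (A : Subset n) → + ∣ A ∣ ≡ sum (λ x → [ x ∈? A ])
  ∣∣≡sum [] = refl
  ∣∣≡sum (s ∷ A) = step s
    where
    tail≡ : + ∣ A ∣ ≡ sum (λ x → [ F.suc x ∈? s ∷ A ])
    tail≡ = trans (∣∣≡sum A) (sum-cong (λ x → []-cong (x ∈? A) (F.suc x ∈? s ∷ A) there drop-there))
    step : ∀ t → + ∣ t ∷ A ∣ ≡ [ F.zero ∈? t ∷ A ] + sum (λ x → [ F.suc x ∈? s ∷ A ])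
    step true  = cong (λ i → 1ℤ + i) tail≡
    step false = trans tail≡ (sym (ℤₚ.+-identityˡ _))

  sumList-allFin : (h : Fin n → ℕ) → + sumList (map h (allFin n)) ≡ sum (λ x → + h x)
  sumList-allFin {n} h = go n (λ i → i)
    where
    go : ∀ m (t : Fin m → Fin n) → + sumList (map h (List.tabulate t)) ≡ sum (λ i → + h (t i))
    go ℕ.zero    t = refl
    go (ℕ.suc m) t = cong (λ i → + h (t F.zero) + i) (go m (t ∘ F.suc))

  𝟙 : Bool → ℤ
  𝟙 true  = 1ℤ
  𝟙 false = 0ℤ

  𝟙-does : ∀ {P : Set} (d : Dec P) → 𝟙 ⌊ d ⌋ ≡ [ d ]
  𝟙-does (yes _) = refl
  𝟙-does (no _)  = refl

  𝟙-mem : .{{_ : NonZero n}} (x : Fin n) (A : Subset n) → 𝟙 (mem x A) ≡ [ x ∈? A ]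
  𝟙-mem x A with mem x A in eq
  ... | true  = sym ([]-yes (x ∈? A) (Equivalence.to T-mem (subst T (sym eq) _)))
  ... | false = sym ([]-no (x ∈? A) (λ x∈A → subst T eq (Equivalence.from (T-mem {x = x} {A}) x∈A)))

-- Representation counts and the size of the sumset.

module SumsetCounts (p : ℕ) .{{_ : NonZero p}} (A : Subset p) where
  open Sums
  open SubsetSums
  open ℤ hiding (suc; ∣_∣; NonZero; _⊖_)

  α : Fin p → ℤ
  α x = [ x ∈? A ]

  term : Fin p → Fin p → Fin p → ℤ
  term x a b = α a * α b * [ a ⊕ b F.≟ x ]

  -- The convolution A*A with values in ℤ; `rep≡` identifies it with `rep A`.
  r : Fin p → ℤ
  r x = sum (λ a → sum (term x a))

  -- The weights in Defs are local definitions without a name; solving the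
  -- existential by refl names them.
  rep-weight : ∀ x → Σ (Fin p → Fin p → ℕ) λ h → rep A x ≡ sumList (map (λ a → sumList (map (h a) (allFin p))) (allFin p))
  rep-weight x = _ , refl

  rep≡ : ∀ x → + rep A x ≡ r x
  rep≡ x = trans (sumList-allFin {p} _) (sum-cong (λ a → trans (sumList-allFin {p} _) (sum-cong (λ b →
      trans (weight a b) (cong₂ _*_ (cong₂ _*_ (𝟙-mem a A) (𝟙-mem b A)) (𝟙-does (a ⊕ b F.≟ x)))))))
    where
    weight : ∀ a b → + proj₁ (rep-weight x) a b ≡ 𝟙 (mem a A) * 𝟙 (mem b A) * 𝟙 ⌊ a ⊕ b F.≟ x ⌋
    weight a b with mem a A | mem b A | ⌊ a ⊕ b F.≟ x ⌋
    ... | true  | true  | true  = refl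
    ... | true  | true  | false = refl
    ... | true  | false | true  = refl
    ... | true  | false | false = refl
    ... | false | true  | true  = refl
    ... | false | true  | false = refl
    ... | false | false | true  = refl
    ... | false | false | false = refl

  sumOver-weight : ∀ (S : Subset p) f → Σ (Fin p → ℕ) λ h → sumOver S f ≡ sumList (map h (allFin p))
  sumOver-weight S f = _ , refl

  sumOver≡ : ∀ (S : Subset p) f → + sumOver S f ≡ sum (λ x → [ x ∈? S ] * + f x)
  sumOver≡ S f = trans (sumList-allFin {p} _) (sum-cong (λ x → trans (weight x) (cong (_* + f x) (𝟙-mem x S))))
    where
    weight : ∀ x → + proj₁ (sumOver-weight S f) x ≡ 𝟙 (mem x S) * + f x
    weight x with mem x S
    ... | true  = sym (ℤₚ.*-identityˡ (+ f x))
    ... | false = refl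

  ∈sumset : ∀ {x} → x ∈ sumset A ⇔ (∃ λ a → ∃ λ b → a ∈ A × b ∈ A × a ⊕ b ≡ x)
  ∈sumset {x} = mk⇔ to from
    where
    mem≡ : mem x (sumset A) ≡ any (λ a → any (λ b → mem a A ∧ mem b A ∧ ⌊ (a ⊕ b) F.≟ x ⌋) (allFin p)) (allFin p)
    mem≡ = lookup∘tabulate _ x
    to : x ∈ sumset A → ∃ λ a → ∃ λ b → a ∈ A × b ∈ A × a ⊕ b ≡ x
    to x∈ with Equivalence.to (any-allFin _) (subst T mem≡ (Equivalence.from T-mem x∈))
    ... | a , t with Equivalence.to (any-allFin _) t
    ... | b , t′ with Equivalence.to Bₚ.T-∧ t′
    ... | a∈ , t″ with Equivalence.to Bₚ.T-∧ t″
    ... | b∈ , eq = a , b , Equivalence.to T-mem a∈ , Equivalence.to T-mem b∈ , toWitness eq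
    from : (∃ λ a → ∃ λ b → a ∈ A × b ∈ A × a ⊕ b ≡ x) → x ∈ sumset A
    from (a , b , a∈ , b∈ , eq) = Equivalence.to T-mem (subst T (sym mem≡)
      (Equivalence.from (any-allFin _) (a , Equivalence.from (any-allFin _) (b ,
        Equivalence.from Bₚ.T-∧ (Equivalence.from T-mem a∈ , Equivalence.from Bₚ.T-∧
          (Equivalence.from T-mem b∈ , fromWitness eq))))))

  sum-α*α : sum (λ a → sum (λ b → α a * α b)) ≡ sum α * sum α
  sum-α*α = sym (sum-* α α)

  -- With x summed innermost, the bracket picks out x = a + b. Weighted sums of A*A thus become sums
  -- over pairs in A².
  sum-*-r : ∀ (g : Fin p → ℤ) → sum (λ x → g x * r x) ≡ sum (λ a → sum (λ b → α a * α b * g (a ⊕ b)))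
  sum-*-r g = begin-equality
    sum (λ x → g x * r x)
      ≡⟨ sum-cong (λ x → trans (*-distribˡ-sum (g x) (λ a → sum (term x a))) (sum-cong (λ a → *-distribˡ-sum (g x) (term x a)))) ⟩
    sum (λ x → sum (λ a → sum (λ b → g x * term x a b)))
      ≡⟨ ∑-comm (λ x a → sum (λ b → g x * term x a b)) ⟩
    sum (λ a → sum (λ x → sum (λ b → g x * term x a b)))
      ≡⟨ sum-cong (λ a → ∑-comm (λ x b → g x * term x a b)) ⟩
    sum (λ a → sum (λ b → sum (λ x → g x * term x a b)))
      ≡⟨ sum-cong (λ a → sum-cong (λ b → trans (sum-cong (λ x → swap (g x) (α a) (α b) [ a ⊕ b F.≟ x ]))
           (trans (sym (*-distribˡ-sum (α a * α b) (λ x → [ a ⊕ b F.≟ x ] * g x))) (cong (α a * α b *_) (sum-point g (a ⊕ b)))))) ⟩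
    sum (λ a → sum (λ b → α a * α b * g (a ⊕ b))) ∎
    where
    open ℤₚ.≤-Reasoning
    swap : ∀ g a b e → g * (a * b * e) ≡ a * b * (e * g)
    swap = solve-∀

  α-yes : ∀ {a} → a ∈ A → α a ≡ 1ℤ
  α-yes {a} = []-yes (a ∈? A)

  -- Every element of A + A has weight at least 2 under `r` + `d`: a sum of distinct a, b is
  -- represented in both orders, and a sum a + a is counted once by `r` and again by the diagonal
  -- term `d`.
  2∣sumset∣≤ : + 2 * sum (λ x → [ x ∈? sumset A ]) ≤ sum α * sum α + sum α
  2∣sumset∣≤ = begin
    + 2 * sum (λ x → [ x ∈? sumset A ])   ≡⟨ *-distribˡ-sum (+ 2) (λ x → [ x ∈? sumset A ]) ⟩
    sum (λ x → + 2 * [ x ∈? sumset A ])   ≤⟨ sum-mono {p} (λ x → pointwise x (x ∈? sumset A)) ⟩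
    sum (λ x → r x + d x)                 ≡⟨ ∑-distrib-+ r d ⟩
    sum r + sum d                         ≡⟨ cong₂ _+_ sum-r sum-d ⟩
    sum α * sum α + sum α                 ∎
    where
    open ℤₚ.≤-Reasoning
    d : Fin p → ℤ
    d x = sum (λ a → α a * [ a ⊕ a F.≟ x ])
    sum-r : sum r ≡ sum α * sum α
    sum-r = trans (sum-cong (λ x → sym (ℤₚ.*-identityˡ (r x)))) (trans (sum-*-r (λ _ → 1ℤ))
      (trans (sum-cong (λ a → sum-cong (λ b → ℤₚ.*-identityʳ (α a * α b)))) sum-α*α))
    sum-d : sum d ≡ sum α
    sum-d = trans (∑-comm (λ x a → α a * [ a ⊕ a F.≟ x ])) (sum-cong (λ a →
      trans (sym (*-distribˡ-sum (α a) (λ x → [ a ⊕ a F.≟ x ])))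
        (trans (cong (α a *_) (count-unique (λ x → a ⊕ a F.≟ x) refl (λ _ eq → eq))) (ℤₚ.*-identityʳ (α a)))))
    0≤term : ∀ x a b → 0ℤ ≤ term x a b
    0≤term x a b = subst (0ℤ ≤_) (sym (ℤₚ.*-assoc (α a) (α b) [ a ⊕ b F.≟ x ]))
      ([]*-nonneg (a ∈? A) ([]*-nonneg (b ∈? A) (0≤[] (a ⊕ b F.≟ x))))
    row : Fin p → Fin p → ℤ
    row x a = sum (term x a)
    0≤row : ∀ x a → 0ℤ ≤ row x a
    0≤row x a = sum-nonneg (0≤term x a)
    row≥ : ∀ {x a b} → a ∈ A → b ∈ A → a ⊕ b ≡ x → 1ℤ ≤ row x a
    row≥ {x} {a} {b} a∈ b∈ eq = subst (_≤ row x a)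
      (cong₂ _*_ (cong₂ _*_ (α-yes a∈) (α-yes b∈)) ([]-yes (a ⊕ b F.≟ x) eq)) (term≤sum {f = term x a} (0≤term x a) b)
    0≤dterm : ∀ x a → 0ℤ ≤ α a * [ a ⊕ a F.≟ x ]
    0≤dterm x a = []*-nonneg (a ∈? A) (0≤[] (a ⊕ a F.≟ x))
    0≤d : ∀ x → 0ℤ ≤ d x
    0≤d x = sum-nonneg (0≤dterm x)
    hit : ∀ x → (∃ λ a → ∃ λ b → a ∈ A × b ∈ A × a ⊕ b ≡ x) → + 2 ≤ r x + d x
    hit x (a , b , a∈ , b∈ , eq) = cases (a F.≟ b)
      where
      cases : Dec (a ≡ b) → + 2 ≤ r x + d x
      cases (yes a≡b) = ℤₚ.+-mono-≤ (ℤₚ.≤-trans (row≥ a∈ b∈ eq) (term≤sum {f = row x} (0≤row x) a))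
        (subst (_≤ d x) (cong₂ _*_ (α-yes a∈) ([]-yes (a ⊕ a F.≟ x) (trans (cong (a ⊕_) a≡b) eq)))
          (term≤sum {f = λ a → α a * [ a ⊕ a F.≟ x ]} (0≤dterm x) a))
      cases (no a≢b) = ℤₚ.+-mono-≤ {+ 2} {r x} {0ℤ} {d x}
        (ℤₚ.≤-trans (ℤₚ.+-mono-≤ (row≥ a∈ b∈ eq) (row≥ b∈ a∈ (trans (Residues.⊕-comm p b a) eq)))
          (two-terms≤sum {f = row x} (0≤row x) a≢b))
        (0≤d x)
    pointwise : ∀ x (e : Dec (x ∈ sumset A)) → + 2 * [ e ] ≤ r x + d x
    pointwise x (no _)   = ℤₚ.+-mono-≤ (sum-nonneg {f = row x} (0≤row x)) (0≤d x)
    pointwise x (yes x∈) = hit x (Equivalence.to ∈sumset x∈)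

-- The second moment of f and the main inequality.

module Inequality (p : ℕ) .{{_ : NonZero p}} (prime : Prime p) (2<p : 2 ℕ.< p) (A : Subset p) where
  open Sums
  open SubsetSums
  open Squares p prime 2<p
  open SumsetCounts p A
  open ℤ hiding (suc; ∣_∣; NonZero; _⊖_)
  open ℤₚ.≤-Reasoning

  k n₁ n₂ : ℤ
  k  = sum α
  n₁ = sum (λ x → [ x ∈? QR ─ sumset A ])
  n₂ = sum (λ x → [ x ∈? sumset A ─ QR ] * r x)

  0≤k : 0ℤ ≤ k
  0≤k = sum-nonneg (λ x → 0≤[] (x ∈? A))

  χ : Fin p → ℤ
  χ x = roots x - 1ℤ

  f : Fin p → ℤ
  f x = sum (λ a → α a * χ (x ⊕ a))

  sum-χ : ∀ a → sum (λ x → χ (x ⊕ a)) ≡ 0ℤ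
  sum-χ a = begin-equality
    sum (λ x → χ (x ⊕ a))       ≡⟨ sum-shift χ a ⟩
    sum χ                       ≡⟨ sum-minus roots (λ _ → 1ℤ) ⟩
    sum roots - sum {p} (λ _ → 1ℤ)
      ≡⟨ cong₂ _-_ sum-roots (trans (sum-const p 1ℤ) (ℤₚ.*-identityʳ (+ p))) ⟩
    + p - + p                   ≡⟨ ℤₚ.+-inverseʳ (+ p) ⟩
    0ℤ                          ∎

  -- Expanding the product, the linear and constant terms together contribute exactly -p, which
  -- cancels the leading p in `correlation`.
  χ-correlation : ∀ a b → sum (λ x → χ (x ⊕ a) * χ (x ⊕ b)) ≤ + p * [ a F.≟ b ] - 1ℤ
  χ-correlation a b = begin
    sum (λ x → χ (x ⊕ a) * χ (x ⊕ b))
      ≡⟨ sum-cong (λ x → expand (roots (x ⊕ a)) (roots (x ⊕ b))) ⟩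
    sum (λ x → roots (x ⊕ a) * roots (x ⊕ b) - (χ (x ⊕ a) + roots (x ⊕ b)))
      ≡⟨ sum-minus (λ x → roots (x ⊕ a) * roots (x ⊕ b)) (λ x → χ (x ⊕ a) + roots (x ⊕ b)) ⟩
    sum (λ x → roots (x ⊕ a) * roots (x ⊕ b)) - sum (λ x → χ (x ⊕ a) + roots (x ⊕ b))
      ≡⟨ cong (λ s → sum (λ x → roots (x ⊕ a) * roots (x ⊕ b)) - s)
           (trans (∑-distrib-+ (λ x → χ (x ⊕ a)) (λ x → roots (x ⊕ b)))
             (cong₂ _+_ (sum-χ a) (trans (sum-shift roots b) sum-roots))) ⟩
    sum (λ x → roots (x ⊕ a) * roots (x ⊕ b)) - (0ℤ + + p)
      ≤⟨ ℤₚ.+-monoˡ-≤ (- (0ℤ + + p)) (correlation a b) ⟩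
    + p + (+ p * [ a F.≟ b ] - 1ℤ) - (0ℤ + + p)
      ≡⟨ cancel (+ p) (+ p * [ a F.≟ b ] - 1ℤ) ⟩
    + p * [ a F.≟ b ] - 1ℤ ∎
    where
    expand : ∀ x y → (x - 1ℤ) * (y - 1ℤ) ≡ x * y - (x - 1ℤ + y)
    expand = solve-∀
    cancel : ∀ x y → x + y - (0ℤ + x) ≡ y
    cancel = solve-∀

  sum-f : sum f ≡ 0ℤ
  sum-f = trans (∑-comm (λ x a → α a * χ (x ⊕ a))) (sum-zero (λ a →
    trans (sym (*-distribˡ-sum (α a) (λ x → χ (x ⊕ a)))) (trans (cong (α a *_) (sum-χ a)) (ℤₚ.*-zeroʳ (α a)))))

  -- Expand the square and sum over x first. The k diagonal pairs contribute p each, and all k²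
  -- pairs contribute -1.
  sum-f² : sum (λ x → f x * f x) ≤ + p * k - k * k
  sum-f² = begin
    sum (λ x → f x * f x)
      ≡⟨ sum-cong (λ x → sum-* (λ a → α a * χ (x ⊕ a)) (λ b → α b * χ (x ⊕ b))) ⟩
    sum (λ x → sum (λ a → sum (λ b → H x a b)))
      ≡⟨ ∑-comm (λ x a → sum (λ b → H x a b)) ⟩
    sum (λ a → sum (λ x → sum (λ b → H x a b)))
      ≡⟨ sum-cong (λ a → ∑-comm (λ x b → H x a b)) ⟩
    sum (λ a → sum (λ b → sum (λ x → H x a b)))
      ≡⟨ sum-cong (λ a → sum-cong (λ b → factor a b)) ⟩
    sum (λ a → sum (λ b → α a * (α b * X a b)))
      -- The correlation is bounded only from above, which suffices because the weights `α` are
      -- nonnegative.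
      ≤⟨ sum-mono {p} (λ a → sum-mono {p} (λ b →
           []*-mono (a ∈? A) (λ _ → []*-mono (b ∈? A) (λ _ → χ-correlation a b)))) ⟩
    sum (λ a → sum (λ b → α a * (α b * (+ p * [ a F.≟ b ] - 1ℤ))))
      ≡⟨ sum-cong row ⟩
    sum (λ a → + p * α a - α a * k)
      ≡⟨ sum-minus (λ a → + p * α a) (λ a → α a * k) ⟩
    sum (λ a → + p * α a) - sum (λ a → α a * k)
      ≡⟨ cong₂ _-_ (sym (*-distribˡ-sum (+ p) α)) (sym (*-distribʳ-sum k α)) ⟩
    + p * k - k * k ∎
    where
    H : Fin p → Fin p → Fin p → ℤ
    H x a b = α a * χ (x ⊕ a) * (α b * χ (x ⊕ b))
    X : Fin p → Fin p → ℤ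
    X a b = sum (λ x → χ (x ⊕ a) * χ (x ⊕ b))
    swap : ∀ a b c d → a * c * (b * d) ≡ a * b * (c * d)
    swap = solve-∀
    factor : ∀ a b → sum (λ x → H x a b) ≡ α a * (α b * X a b)
    factor a b = trans (sum-cong (λ x → swap (α a) (α b) (χ (x ⊕ a)) (χ (x ⊕ b))))
      (trans (sym (*-distribˡ-sum (α a * α b) (λ x → χ (x ⊕ a) * χ (x ⊕ b)))) (ℤₚ.*-assoc (α a) (α b) (X a b)))
    spread : ∀ q s t e → s * (t * (q * e - 1ℤ)) ≡ q * s * (e * t) - s * t
    spread = solve-∀
    row : ∀ a → sum (λ b → α a * (α b * (+ p * [ a F.≟ b ] - 1ℤ))) ≡ + p * α a - α a * k
    row a = begin-equality
      sum (λ b → α a * (α b * (+ p * [ a F.≟ b ] - 1ℤ)))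
        ≡⟨ sum-cong (λ b → spread (+ p) (α a) (α b) [ a F.≟ b ]) ⟩
      sum (λ b → + p * α a * ([ a F.≟ b ] * α b) - α a * α b)
        ≡⟨ sum-minus (λ b → + p * α a * ([ a F.≟ b ] * α b)) (λ b → α a * α b) ⟩
      sum (λ b → + p * α a * ([ a F.≟ b ] * α b)) - sum (λ b → α a * α b)
        ≡⟨ cong₂ _-_ (trans (sym (*-distribˡ-sum (+ p * α a) (λ b → [ a F.≟ b ] * α b)))
                       (cong (+ p * α a *_) (sum-point α a)))
                     (sym (*-distribˡ-sum (α a) α)) ⟩
      + p * α a * α a - α a * k
        ≡⟨ cong (λ s → s - α a * k) (trans (ℤₚ.*-assoc (+ p) (α a) (α a)) (cong (+ p *_) ([]-idem (a ∈? A)))) ⟩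
      + p * α a - α a * k ∎

  0≤i² : ∀ i → 0ℤ ≤ i * i
  0≤i² (+ n)    = subst (0ℤ ≤_) (ℤₚ.pos-* n n) (+≤+ ℕ.z≤n)
  0≤i² -[1+ n ] = +≤+ ℕ.z≤n

  -- A product i(i + 1) of consecutive integers is never negative; this fails for real i between -1
  -- and 0.
  0≤i²+i : ∀ i → 0ℤ ≤ i * i + i
  0≤i²+i (+ n)    = ℤₚ.+-mono-≤ (0≤i² (+ n)) (+≤+ ℕ.z≤n)
  0≤i²+i -[1+ n ] = subst (0ℤ ≤_) (sym (factor -[1+ n ])) (0≤-*- n)
    where
    factor : ∀ i → i * i + i ≡ i * (i + 1ℤ)
    factor = solve-∀
    0≤-*- : ∀ n → 0ℤ ≤ -[1+ n ] * (-[1+ n ] + 1ℤ)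
    0≤-*- ℕ.zero    = +≤+ ℕ.z≤n
    0≤-*- (ℕ.suc n) = +≤+ ℕ.z≤n

  -- On A the tangent (f - k)² ≥ 0 is used, off A the integrality bound f² + f ≥ 0.
  energy : (+ 2 * k + 1ℤ) * sum (λ x → α x * f x) - k * k * k ≤ + p * k - k * k
  energy = begin
    (+ 2 * k + 1ℤ) * sum (λ x → α x * f x) - k * k * k
      ≡⟨ cong₂ _-_ (*-distribˡ-sum (+ 2 * k + 1ℤ) (λ x → α x * f x)) (*-distribˡ-sum (k * k) α) ⟩
    sum (λ x → (+ 2 * k + 1ℤ) * (α x * f x)) - sum (λ x → k * k * α x)
      ≡⟨ sym (sum-minus (λ x → (+ 2 * k + 1ℤ) * (α x * f x)) (λ x → k * k * α x)) ⟩
    sum (λ x → (+ 2 * k + 1ℤ) * (α x * f x) - k * k * α x)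
      ≤⟨ sum-mono {p} (λ x → pointwise (x ∈? A) (f x)) ⟩
    sum (λ x → f x * f x + f x)     ≡⟨ ∑-distrib-+ (λ x → f x * f x) f ⟩
    -- Adding the linear term f costs nothing, since f sums to zero.
    sum (λ x → f x * f x) + sum f   ≡⟨ trans (cong (λ s → sum (λ x → f x * f x) + s) sum-f) (ℤₚ.+-identityʳ _) ⟩
    sum (λ x → f x * f x)           ≤⟨ sum-f² ⟩
    + p * k - k * k                 ∎
    where
    off : ∀ k i → (+ 2 * k + 1ℤ) * (0ℤ * i) - k * k * 0ℤ ≡ 0ℤ
    off = solve-∀
    on : ∀ k i → (i - k) * (i - k) ≡ i * i + i - ((+ 2 * k + 1ℤ) * (1ℤ * i) - k * k * 1ℤ)
    on = solve-∀
    pointwise : ∀ {P : Set} (d : Dec P) i → (+ 2 * k + 1ℤ) * ([ d ] * i) - k * k * [ d ] ≤ i * i + i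
    pointwise (no _)  i = subst (_≤ i * i + i) (sym (off k i)) (0≤i²+i i)
    pointwise (yes _) i = ℤₚ.0≤i-j⇒j≤i (subst (0ℤ ≤_) (on k i) (0≤i² (i - k)))

  1≤QR+sumset─QR : ∀ {x} → x ∈ sumset A → 1ℤ ≤ [ x ∈? QR ] + [ x ∈? sumset A ─ QR ]
  1≤QR+sumset─QR {x} x∈ = cases (x ∈? QR)
    where
    cases : (d : Dec (x ∈ QR)) → 1ℤ ≤ [ d ] + [ x ∈? sumset A ─ QR ]
    cases (yes _)  = ℤₚ.+-monoʳ-≤ 1ℤ (0≤[] (x ∈? sumset A ─ QR))
    cases (no x∉)  = ℤₚ.≤-reflexive (sym (cong (λ i → 0ℤ + i)
      ([]-yes (x ∈? sumset A ─ QR) (x∈p∧x∉q⇒x∈p─q x∈ x∉))))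

  -- The left side of the comparison counts 1 for each pair of A², less 2 for each pair with sum
  -- outside `QR`. This is safe since χ is at least 1 on `QR` and at least -1 everywhere.
  mass-on-A : k * k - + 2 * n₂ ≤ sum (λ x → α x * f x)
  mass-on-A = begin
    k * k - + 2 * n₂
      ≡⟨ cong₂ (λ s t → s - + 2 * t) (sum-* α α) (sum-*-r δ) ⟩
    sum (λ a → sum (λ b → α a * α b)) - + 2 * sum (λ a → sum (λ b → α a * α b * δ (a ⊕ b)))
      ≡⟨ cong (λ s → sum (λ a → sum (λ b → α a * α b)) - s)
           (trans (*-distribˡ-sum (+ 2) (λ a → sum (λ b → α a * α b * δ (a ⊕ b))))
             (sum-cong (λ a → *-distribˡ-sum (+ 2) (λ b → α a * α b * δ (a ⊕ b))))) ⟩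
    sum (λ a → sum (λ b → α a * α b)) - sum (λ a → sum (λ b → + 2 * (α a * α b * δ (a ⊕ b))))
      ≡⟨ sym (trans (sum-cong (λ a → sum-minus (λ b → α a * α b) (λ b → + 2 * (α a * α b * δ (a ⊕ b)))))
           (sum-minus (λ a → sum (λ b → α a * α b)) (λ a → sum (λ b → + 2 * (α a * α b * δ (a ⊕ b)))))) ⟩
    sum (λ a → sum (λ b → α a * α b - + 2 * (α a * α b * δ (a ⊕ b))))
      ≡⟨ sum-cong (λ a → sum-cong (λ b → factor (α a) (α b) (δ (a ⊕ b)))) ⟩
    sum (λ a → sum (λ b → α a * (α b * (1ℤ - + 2 * δ (a ⊕ b)))))
      ≤⟨ sum-mono {p} (λ a → sum-mono {p} (λ b →
           []*-mono (a ∈? A) (λ a∈ → []*-mono (b ∈? A) (λ b∈ → χ≥ (Equivalence.from ∈sumset (a , b , a∈ , b∈ , refl)))))) ⟩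
    sum (λ a → sum (λ b → α a * (α b * χ (a ⊕ b))))
      ≡⟨ sum-cong (λ a → sym (*-distribˡ-sum (α a) (λ b → α b * χ (a ⊕ b)))) ⟩
    sum (λ a → α a * f a) ∎
    where
    δ : Fin p → ℤ
    δ x = [ x ∈? sumset A ─ QR ]
    factor : ∀ a b d → a * b - + 2 * (a * b * d) ≡ a * (b * (1ℤ - + 2 * d))
    factor = solve-∀
    -- The gap χ - (1 - 2δ) is the slack of `roots≥` plus twice the slack of `1≤QR+sumset─QR`.
    split : ∀ q d t → (t - + 2 * q) + + 2 * (q + d - 1ℤ) ≡ (t - 1ℤ) - (1ℤ - + 2 * d)
    split = solve-∀
    χ≥ : ∀ {x} → x ∈ sumset A → 1ℤ - + 2 * δ x ≤ χ x
    χ≥ {x} x∈ = ℤₚ.0≤i-j⇒j≤i (subst (0ℤ ≤_) (split [ x ∈? QR ] (δ x) (roots x))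
      (ℤₚ.+-mono-≤ (ℤₚ.i≤j⇒0≤j-i (roots≥ x)) (ℤₚ.*-monoˡ-≤-nonNeg (+ 2) (ℤₚ.i≤j⇒0≤j-i (1≤QR+sumset─QR x∈)))))

  -- `QR` is covered by its part outside the sumset and the sumset itself, so `p≤1+2∣QR∣` and
  -- `2∣sumset∣≤` combine.
  p≤ : + p ≤ 1ℤ + + 2 * n₁ + k * k + k
  p≤ = begin
    + p                                        ≤⟨ p≤1+2∣QR∣ ⟩
    1ℤ + + 2 * sum (λ x → [ x ∈? QR ])         ≤⟨ ℤₚ.+-monoʳ-≤ 1ℤ (ℤₚ.*-monoˡ-≤-nonNeg (+ 2) (sum-mono {p} (λ x → pointwise x (x ∈? sumset A)))) ⟩
    1ℤ + + 2 * sum (λ x → [ x ∈? QR ─ sumset A ] + [ x ∈? sumset A ])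
      ≡⟨ cong (λ s → 1ℤ + + 2 * s) (∑-distrib-+ (λ x → [ x ∈? QR ─ sumset A ]) (λ x → [ x ∈? sumset A ])) ⟩
    1ℤ + + 2 * (n₁ + sum (λ x → [ x ∈? sumset A ]))
      ≡⟨ distrib n₁ (sum (λ x → [ x ∈? sumset A ])) ⟩
    1ℤ + + 2 * n₁ + + 2 * sum (λ x → [ x ∈? sumset A ])
      ≤⟨ ℤₚ.+-monoʳ-≤ (1ℤ + + 2 * n₁) 2∣sumset∣≤ ⟩
    1ℤ + + 2 * n₁ + (k * k + k)                ≡⟨ sym (ℤₚ.+-assoc (1ℤ + + 2 * n₁) (k * k) k) ⟩
    1ℤ + + 2 * n₁ + k * k + k                  ∎
    where
    distrib : ∀ m s → 1ℤ + + 2 * (m + s) ≡ 1ℤ + + 2 * m + + 2 * s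
    distrib = solve-∀
    pointwise : ∀ x (d : Dec (x ∈ sumset A)) → [ x ∈? QR ] ≤ [ x ∈? QR ─ sumset A ] + [ d ]
    pointwise x (yes _) = ℤₚ.≤-trans ([]-mono (x ∈? QR) (yes x) (λ _ → x)) (ℤₚ.+-monoˡ-≤ 1ℤ (0≤[] (x ∈? QR ─ sumset A)))
    pointwise x (no x∉) = subst ([ x ∈? QR ] ≤_) (sym (ℤₚ.+-identityʳ _))
      ([]-mono (x ∈? QR) (x ∈? QR ─ sumset A) (λ x∈ → x∈p∧x∉q⇒x∈p─q x∈ x∉))

  -- Add the first inequality, 2k + 1 times the second and k times the third: s, pk and the cubic
  -- terms all cancel.
  combine : ∀ k p s m n → 0ℤ ≤ k →
    (+ 2 * k + 1ℤ) * s - k * k * k ≤ p * k - k * k → k * k - + 2 * n ≤ s → p ≤ 1ℤ + + 2 * m + k * k + k →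
    k * k ≤ k + + 2 * k * m + (+ 4 * k + + 2) * n
  combine k@(+ _) p s m n _ I₁ I₂ I₃ = ℤₚ.0≤i-j⇒j≤i (subst (0ℤ ≤_) (identity k p s m n)
    (ℤₚ.+-mono-≤ (ℤₚ.+-mono-≤ (ℤₚ.i≤j⇒0≤j-i I₁) (0≤* {+ 2 * k + 1ℤ} 0≤2k+1 (ℤₚ.i≤j⇒0≤j-i I₂)))
      (0≤* {k} (+≤+ ℕ.z≤n) (ℤₚ.i≤j⇒0≤j-i I₃))))
    where
    0≤* : ∀ {i j} → 0ℤ ≤ i → 0ℤ ≤ j → 0ℤ ≤ i * j
    0≤* {+ i} {+ j} _ _ = subst (0ℤ ≤_) (ℤₚ.pos-* i j) (+≤+ ℕ.z≤n)
    0≤2k+1 : 0ℤ ≤ + 2 * k + 1ℤ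
    0≤2k+1 = ℤₚ.+-mono-≤ (0≤* {+ 2} {k} (+≤+ ℕ.z≤n) (+≤+ ℕ.z≤n)) (+≤+ ℕ.z≤n)
    identity : ∀ k p s m n → p * k - k * k - ((+ 2 * k + 1ℤ) * s - k * k * k)
      + (+ 2 * k + 1ℤ) * (s - (k * k - + 2 * n)) + k * (1ℤ + + 2 * m + k * k + k - p)
      ≡ k + + 2 * k * m + (+ 4 * k + + 2) * n - k * k
    identity = solve-∀

  k²≤ : k * k ≤ k + + 2 * k * n₁ + (+ 4 * k + + 2) * n₂
  k²≤ = combine k (+ p) (sum (λ x → α x * f x)) n₁ n₂ 0≤k energy mass-on-A p≤

  private
    K N₁ N₂ : ℕ
    K = ∣ A ∣
    N₁ = ∣ QR ─ sumset A ∣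
    N₂ = sumOver (sumset A ─ QR) (rep A)

    k≡ : k ≡ + K
    k≡ = sym (∣∣≡sum A)
    n₁≡ : n₁ ≡ + N₁
    n₁≡ = sym (∣∣≡sum (QR ─ sumset A))
    n₂≡ : n₂ ≡ + N₂
    n₂≡ = sym (trans (sumOver≡ (sumset A ─ QR) (rep A)) (sum-cong (λ x → cong ([ x ∈? sumset A ─ QR ] *_) (rep≡ x))))

  p≤ℕ : p ℕ.≤ 1 ℕ.+ 2 ℕ.* N₁ ℕ.+ K ℕ.* K ℕ.+ K
  p≤ℕ = ℤₚ.drop‿+≤+ (subst (+ p ≤_) eq p≤)
    where
    eq : 1ℤ + + 2 * n₁ + k * k + k ≡ + (1 ℕ.+ 2 ℕ.* N₁ ℕ.+ K ℕ.* K ℕ.+ K)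
    eq rewrite k≡ | n₁≡ = cong₂ (λ i j → 1ℤ + i + j + + K) (sym (ℤₚ.pos-* 2 N₁)) (sym (ℤₚ.pos-* K K))

  k²≤ℕ : K ℕ.* K ℕ.≤ K ℕ.+ 2 ℕ.* K ℕ.* N₁ ℕ.+ (4 ℕ.* K ℕ.+ 2) ℕ.* N₂
  k²≤ℕ = ℤₚ.drop‿+≤+ (subst₂ _≤_ lhs rhs k²≤)
    where
    lhs : k * k ≡ + (K ℕ.* K)
    lhs rewrite k≡ = sym (ℤₚ.pos-* K K)
    rhs : k + + 2 * k * n₁ + (+ 4 * k + + 2) * n₂ ≡ + (K ℕ.+ 2 ℕ.* K ℕ.* N₁ ℕ.+ (4 ℕ.* K ℕ.+ 2) ℕ.* N₂)
    rhs = trans (cong₂ (λ i j → i + j) (cong₂ (λ i j → i + + 2 * i * j) k≡ n₁≡) (cong₂ (λ i j → (+ 4 * i + + 2) * j) k≡ n₂≡))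
      (sym (cong₂ (λ i j → + K + i + j)
        (trans (ℤₚ.pos-* (2 ℕ.* K) N₁) (cong (_* + N₁) (ℤₚ.pos-* 2 K)))
        (trans (ℤₚ.pos-* (4 ℕ.* K ℕ.+ 2) N₂) (cong (λ i → (i + + 2) * + N₂) (ℤₚ.pos-* 4 K)))))

-- The exact case A + A = R.

p─p-empty : ∀ {n} {x : Fin n} (S : Subset n) → ¬ x ∈ S ─ S
p─p-empty (true  ∷ S) (there x∈) = p─p-empty S x∈
p─p-empty (false ∷ S) (there x∈) = p─p-empty S x∈

module _ {p : ℕ} .{{_ : NonZero p}} (A : Subset p) (eq : sumset A ≡ QR) where
  open Sums
  open SubsetSums

  ∣QR─sumset∣≡0 : ∣ QR ─ sumset A ∣ ≡ 0
  ∣QR─sumset∣≡0 rewrite eq = ℤₚ.+-injective (trans (∣∣≡sum (QR {p} ─ QR))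
    (sum-zero (λ x → []-no (x ∈? QR ─ QR) (p─p-empty QR))))

  sumOver-sumset─QR≡0 : sumOver (sumset A ─ QR) (rep A) ≡ 0
  sumOver-sumset─QR≡0 rewrite eq = ℤₚ.+-injective (trans (SumsetCounts.sumOver≡ p A (QR ─ QR) (rep A))
    (sum-zero (λ x → cong (ℤ._* ℤ.+ rep A x) ([]-no (x ∈? QR ─ QR) (p─p-empty QR)))))

-- The counting argument requires an odd prime, so p = 2 is settled by evaluating all four subsets.
sumset≢QR-2 : .{{_ : NonZero 2}} (A : Subset 2) → sumset A ≢ QR
sumset≢QR-2 (false ∷ false ∷ []) ()
sumset≢QR-2 (false ∷ true  ∷ []) ()
sumset≢QR-2 (true  ∷ false ∷ []) ()
sumset≢QR-2 (true  ∷ true  ∷ []) ()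

-- Evaluation of the eight subsets: only {2} has sumset {1}.
sumset≡QR-3 : .{{_ : NonZero 3}} (A : Subset 3) → sumset A ≡ QR → (x : Fin 3) → (x ∈ A) ⇔ (toℕ x ≡ 2)
sumset≡QR-3 (false ∷ false ∷ false ∷ []) ()
sumset≡QR-3 (false ∷ true  ∷ false ∷ []) ()
sumset≡QR-3 (false ∷ true  ∷ true  ∷ []) ()
sumset≡QR-3 (true  ∷ false ∷ false ∷ []) ()
sumset≡QR-3 (true  ∷ false ∷ true  ∷ []) ()
sumset≡QR-3 (true  ∷ true  ∷ false ∷ []) ()
sumset≡QR-3 (true  ∷ true  ∷ true  ∷ []) ()
sumset≡QR-3 (false ∷ false ∷ true  ∷ []) _ F.zero                 = mk⇔ (λ ()) (λ ())
sumset≡QR-3 (false ∷ false ∷ true  ∷ []) _ (F.suc F.zero)         = mk⇔ (λ { (there ()) }) (λ ())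
sumset≡QR-3 (false ∷ false ∷ true  ∷ []) _ (F.suc (F.suc F.zero)) = mk⇔ (λ _ → refl) (λ _ → there (there here))

-- After p = 2 and p = 3, any further prime is at least 4. With both defects zero, `k²≤ℕ` gives at
-- most one element in A, and then `p≤ℕ` gives p at most 3.
sumset≡QR⇒ : (p : ℕ) .{{_ : NonZero p}} → Prime p → (A : Subset p) →
  sumset A ≡ QR → p ≡ 3 × ((x : Fin p) → (x ∈ A) ⇔ (toℕ x ≡ 2))
sumset≡QR⇒ (ℕ.suc ℕ.zero) pr = contradiction (ℕ.nonTrivial⇒n>1 1 {{prime⇒nonTrivial pr}}) λ { (ℕ.s≤s ()) }
sumset≡QR⇒ 2 _ A eq = contradiction eq (sumset≢QR-2 A)
sumset≡QR⇒ 3 _ A eq = refl , sumset≡QR-3 A eq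
sumset≡QR⇒ p@(ℕ.suc (ℕ.suc (ℕ.suc (ℕ.suc q)))) pr A eq = contradiction p≤3 λ { (ℕ.s≤s (ℕ.s≤s (ℕ.s≤s ()))) }
  where
  open Inequality p pr (ℕ.s≤s (ℕ.s≤s (ℕ.s≤s ℕ.z≤n))) A
  k≤1 : ∀ k → k ℕ.* k ℕ.≤ k ℕ.+ 2 ℕ.* k ℕ.* 0 ℕ.+ (4 ℕ.* k ℕ.+ 2) ℕ.* 0 → k ℕ.≤ 1
  k≤1 ℕ.zero    _ = ℕ.z≤n
  k≤1 k@(ℕ.suc _) h = ℕₚ.*-cancelˡ-≤ k (subst (k ℕ.* k ℕ.≤_) (simplify k) h)
    where
    simplify : ∀ k → k ℕ.+ 2 ℕ.* k ℕ.* 0 ℕ.+ (4 ℕ.* k ℕ.+ 2) ℕ.* 0 ≡ k ℕ.* 1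
    simplify = ℕSolver.solve-∀
  ∣A∣≤1 : ∣ A ∣ ℕ.≤ 1
  ∣A∣≤1 = k≤1 ∣ A ∣ (subst₂ (λ m n → ∣ A ∣ ℕ.* ∣ A ∣ ℕ.≤ ∣ A ∣ ℕ.+ 2 ℕ.* ∣ A ∣ ℕ.* m ℕ.+ (4 ℕ.* ∣ A ∣ ℕ.+ 2) ℕ.* n)
    (∣QR─sumset∣≡0 A eq) (sumOver-sumset─QR≡0 A eq) k²≤ℕ)
  p≤3 : p ℕ.≤ 3
  p≤3 = ℕₚ.≤-trans (subst (λ m → p ℕ.≤ 1 ℕ.+ 2 ℕ.* m ℕ.+ ∣ A ∣ ℕ.* ∣ A ∣ ℕ.+ ∣ A ∣) (∣QR─sumset∣≡0 A eq) p≤ℕ)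
    (ℕₚ.+-mono-≤ (ℕₚ.+-monoʳ-≤ 1 (ℕₚ.*-mono-≤ ∣A∣≤1 ∣A∣≤1)) ∣A∣≤1)

-- The quantitative bound over the natural numbers.

module _ where
  open import Data.Nat
  open ℕₚ.≤-Reasoning

  -- The conclusion is (1/6 - 1/D)k ≤ M with denominators cleared. It is immediate if k ≤ 2M.
  -- Otherwise a small k contradicts the size of p, and a large k makes the additive error in k ≤ 6M
  -- + 2 negligible.
  Dk≤6DM+6k : ∀ D k M p → k * k ≤ k + (6 * k + 2) * M → p ≤ 1 + 2 * M + k * k + k →
    p > 1 + D * D + 2 * D → D * k ≤ 6 * D * M + 6 * k
  Dk≤6DM+6k D k M p k²≤ p≤ p> with ℕₚ.≤-<-connex k (2 * M)
  ... | inj₁ k≤2M = begin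
    D * k                ≤⟨ ℕₚ.*-monoʳ-≤ D k≤2M ⟩
    D * (2 * M)          ≤⟨ ℕₚ.m≤m+n _ (4 * D * M + 6 * k) ⟩
    D * (2 * M) + (4 * D * M + 6 * k) ≡⟨ regroup D M k ⟩
    6 * D * M + 6 * k    ∎
    where
    regroup : ∀ D M k → D * (2 * M) + (4 * D * M + 6 * k) ≡ 6 * D * M + 6 * k
    regroup = ℕSolver.solve-∀
  ... | inj₂ 2M<k with ℕₚ.≤-<-connex D k
  -- Both k and 2M are at most D here, so p is at most 1 + D + D² + D; the threshold on p is exactly
  -- this number.
  ... | inj₂ k<D = contradiction p> (ℕₚ.≤⇒≯ (begin
    p                          ≤⟨ p≤ ⟩
    1 + 2 * M + k * k + k      ≤⟨ ℕₚ.+-mono-≤ (ℕₚ.+-mono-≤ (ℕₚ.+-monoʳ-≤ 1 2M≤D) (ℕₚ.*-mono-≤ k≤D k≤D)) k≤D ⟩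
    1 + D + D * D + D          ≡⟨ regroup D ⟩
    1 + D * D + 2 * D          ∎))
    where
    k≤D : k ≤ D
    k≤D = ℕₚ.<⇒≤ k<D
    2M≤D : 2 * M ≤ D
    2M≤D = ℕₚ.≤-trans (ℕₚ.<⇒≤ 2M<k) k≤D
    regroup : ∀ D → 1 + D + D * D + D ≡ 1 + D * D + 2 * D
    regroup = ℕSolver.solve-∀
  ... | inj₁ D≤k = begin
    D * k                      ≤⟨ ℕₚ.*-monoʳ-≤ D k≤6M+2 ⟩
    D * (6 * M + 2)            ≡⟨ regroup D M ⟩
    -- From D ≤ k, the error 2D is absorbed by 6k.
    6 * D * M + 2 * D          ≤⟨ ℕₚ.+-monoʳ-≤ (6 * D * M) (ℕₚ.*-mono-≤ {2} {6} (s≤s (s≤s z≤n)) D≤k) ⟩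
    6 * D * M + 6 * k          ∎
    where
    regroup : ∀ D M → D * (6 * M + 2) ≡ 6 * D * M + 2 * D
    regroup = ℕSolver.solve-∀
    instance
      k≢0 : NonZero k
      k≢0 = ℕ.>-nonZero (ℕₚ.≤-<-trans z≤n 2M<k)
    split : ∀ k M → k + (6 * k + 2) * M ≡ k + 6 * k * M + 2 * M
    split = ℕSolver.solve-∀
    merge : ∀ k M → k + 6 * k * M + k ≡ k * (6 * M + 2)
    merge = ℕSolver.solve-∀
    k≤6M+2 : k ≤ 6 * M + 2
    k≤6M+2 = ℕₚ.*-cancelˡ-≤ k (begin
      k * k                    ≤⟨ k²≤ ⟩
      k + (6 * k + 2) * M      ≡⟨ split k M ⟩
      -- Replacing 2M by the larger k makes every term a multiple of k, which can then be cancelled.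
      k + 6 * k * M + 2 * M    ≤⟨ ℕₚ.+-monoʳ-≤ (k + 6 * k * M) (ℕₚ.<⇒≤ 2M<k) ⟩
      k + 6 * k * M + k        ≡⟨ merge k M ⟩
      k * (6 * M + 2)          ∎)

  sumset-defect : ∀ D p .{{_ : NonZero p}} → p > 1 + D * D + 2 * D → 1 ≤ D → Prime p → (A : Subset p) →
    D * ∣ A ∣ ≤ 6 * D * (∣ QR ─ sumset A ∣ ⊔ sumOver (sumset A ─ QR) (rep A)) + 6 * ∣ A ∣
  sumset-defect D p p> 1≤D pr A = Dk≤6DM+6k D k M p
    (begin
      k * k                                  ≤⟨ k²≤ℕ ⟩
      k + 2 * k * n₁ + (4 * k + 2) * n₂      ≤⟨ ℕₚ.+-mono-≤ (ℕₚ.+-monoʳ-≤ k (ℕₚ.*-monoʳ-≤ (2 * k) n₁≤M)) (ℕₚ.*-monoʳ-≤ (4 * k + 2) n₂≤M) ⟩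
      -- The coefficients 2k and 4k + 2 add up to 6k + 2, the source of the constant 1/6.
      k + 2 * k * M + (4 * k + 2) * M        ≡⟨ merge k M ⟩
      k + (6 * k + 2) * M                    ∎)
    (begin
      p                              ≤⟨ p≤ℕ ⟩
      1 + 2 * n₁ + k * k + k         ≤⟨ ℕₚ.+-monoˡ-≤ k (ℕₚ.+-monoˡ-≤ (k * k) (ℕₚ.+-monoʳ-≤ 1 (ℕₚ.*-monoʳ-≤ 2 n₁≤M))) ⟩
      1 + 2 * M + k * k + k          ∎)
    p>
    where
    2<p : 2 < p
    -- For D ≥ 1 the threshold is at least 4, which excludes the prime 2.
    2<p = ℕₚ.<-trans (ℕₚ.≤-trans (s≤s (s≤s (s≤s z≤n))) (ℕₚ.+-mono-≤ (ℕₚ.+-monoʳ-≤ 1 (ℕₚ.*-mono-≤ 1≤D 1≤D)) (ℕₚ.*-monoʳ-≤ 2 1≤D))) p>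
    open Inequality p pr 2<p A using (k²≤ℕ; p≤ℕ)
    k n₁ n₂ M : ℕ
    k = ∣ A ∣
    n₁ = ∣ QR ─ sumset A ∣
    n₂ = sumOver (sumset A ─ QR) (rep A)
    M = n₁ ⊔ n₂
    n₁≤M : n₁ ≤ M
    n₁≤M = ℕₚ.m≤m⊔n n₁ n₂
    n₂≤M : n₂ ≤ M
    n₂≤M = ℕₚ.m≤n⊔m n₁ n₂
    merge : ∀ k M → k + 2 * k * M + (4 * k + 2) * M ≡ k + (6 * k + 2) * M
    merge = ℕSolver.solve-∀

-- Passage to rational ε.

open import Data.Integer using (+_)
open import Data.Rational using (ℚ; mkℚ; toℚᵘ; _/_; _-_; _*_; _≤_; Positive)

module _ where
  open ℤ using (0ℤ)

  -- With ε = (1 + e)/D, the hypothesis `h` is the bound for 1/D, and the surplus e/D only adds the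
  -- nonnegative slack 6ek. The conclusion has the shape of the unfolded order on unnormalised
  -- rationals.
  cross-multiply : ∀ e D k M → 0ℤ ℤ.≤ D ℤ.* (+ 6 ℤ.* M) ℤ.+ + 6 ℤ.* k ℤ.- D ℤ.* k → 0ℤ ℤ.≤ e ℤ.* k →
    (+ 1 ℤ.* D ℤ.+ ℤ.- (+ 1 ℤ.+ e) ℤ.* + 6) ℤ.* k ℤ.* + 1 ℤ.≤ M ℤ.* (+ 6 ℤ.* D)
  cross-multiply e D k M h h′ = ℤₚ.0≤i-j⇒j≤i (subst (0ℤ ℤ.≤_) (identity e D k M)
    (ℤₚ.+-mono-≤ h (ℤₚ.*-monoˡ-≤-nonNeg (+ 6) h′)))
    where
    identity : ∀ e D k M → D ℤ.* (+ 6 ℤ.* M) ℤ.+ + 6 ℤ.* k ℤ.- D ℤ.* k ℤ.+ + 6 ℤ.* (e ℤ.* k)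
      ≡ M ℤ.* (+ 6 ℤ.* D) ℤ.- (+ 1 ℤ.* D ℤ.+ ℤ.- (+ 1 ℤ.+ e) ℤ.* + 6) ℤ.* k ℤ.* + 1
    identity = solve-∀

-- The comparison moves to unnormalised rationals, where no reduction to lowest terms intervenes and
-- the order unfolds to a cross-multiplied integer inequality.
[1/6-ε]k≤M : ∀ e d .(c : Coprime ℤ.∣ + ℕ.suc e ∣ (ℕ.suc d)) k M → ℕ.suc d ℕ.* k ℕ.≤ 6 ℕ.* ℕ.suc d ℕ.* M ℕ.+ 6 ℕ.* k →
  ((+ 1 / 6) - mkℚ (+ ℕ.suc e) d c) * (+ k / 1) ≤ + M / 1
[1/6-ε]k≤M e d c k M h = ℚₚ.toℚᵘ-cancel-≤
  (ℚᵘₚ.≤-respˡ-≃ (ℚᵘₚ.≃-sym lhs) (ℚᵘₚ.≤-respʳ-≃ (ℚᵘₚ.≃-sym (ℚₚ.toℚᵘ-fromℚᵘ (ℚᵘ.mkℚᵘ (+ M) 0))) core))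
  where
  ε : ℚ
  ε = mkℚ (+ ℕ.suc e) d c
  εᵘ : ℚᵘ.ℚᵘ
  εᵘ = ℚᵘ.mkℚᵘ (+ ℕ.suc e) d
  lhs : toℚᵘ (((+ 1 / 6) - ε) * (+ k / 1)) ℚᵘ.≃ (ℚᵘ.mkℚᵘ (+ 1) 5 ℚᵘ.- εᵘ) ℚᵘ.* ℚᵘ.mkℚᵘ (+ k) 0
  lhs = ℚᵘₚ.≃-trans (ℚₚ.toℚᵘ-homo-* ((+ 1 / 6) - ε) (+ k / 1))
    (ℚᵘₚ.*-cong (ℚₚ.toℚᵘ-homo-+ (+ 1 / 6) (Data.Rational.- ε)) (ℚₚ.toℚᵘ-fromℚᵘ (ℚᵘ.mkℚᵘ (+ k) 0)))
  gap : ℤ.0ℤ ℤ.≤ + ℕ.suc d ℤ.* (+ 6 ℤ.* + M) ℤ.+ + 6 ℤ.* + k ℤ.- + ℕ.suc d ℤ.* + k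
  gap = ℤₚ.i≤j⇒0≤j-i (subst₂ ℤ._≤_ (ℤₚ.pos-* (ℕ.suc d) k)
    (cong₂ ℤ._+_ (trans (cong +_ (reorder (ℕ.suc d) M)) (trans (ℤₚ.pos-* (ℕ.suc d) (6 ℕ.* M)) (cong (+ ℕ.suc d ℤ.*_) (ℤₚ.pos-* 6 M)))) (ℤₚ.pos-* 6 k))
    (ℤ.+≤+ h))
    where
    reorder : ∀ D M → 6 ℕ.* D ℕ.* M ≡ D ℕ.* (6 ℕ.* M)
    reorder = ℕSolver.solve-∀
  core : (ℚᵘ.mkℚᵘ (+ 1) 5 ℚᵘ.- εᵘ) ℚᵘ.* ℚᵘ.mkℚᵘ (+ k) 0 ℚᵘ.≤ ℚᵘ.mkℚᵘ (+ M) 0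
  core = ℚᵘ.*≤* (subst (λ q → ℚᵘ.↥ ((ℚᵘ.mkℚᵘ (+ 1) 5 ℚᵘ.- εᵘ) ℚᵘ.* ℚᵘ.mkℚᵘ (+ k) 0) ℤ.* + 1 ℤ.≤ + M ℤ.* + q) (sym (ℕₚ.*-identityʳ (6 ℕ.* ℕ.suc d)))
    (cross-multiply (+ e) (+ ℕ.suc d) (+ k) (+ M) gap (subst (ℤ.0ℤ ℤ.≤_) (ℤₚ.pos-* e k) (ℤ.+≤+ ℕ.z≤n))))

theorem14 : ((p : ℕ) .{{_ : NonZero p}} → Prime p → (A : Subset p) →
    sumset A ≡ QR → p ≡ 3 × ((x : Fin p) → (x ∈ A) ⇔ (toℕ x ≡ 2)))
    ×
    ((ε : ℚ) → Positive ε → Σ ℕ λ p₀ →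
    (p : ℕ) .{{_ : NonZero p}} → p > p₀ → Prime p → (A : Subset p) →
    ((+ 1 / 6) - ε) * (+ ∣ A ∣ / 1)
    ≤ (+ (∣ QR ─ sumset A ∣ ⊔ sumOver (sumset A ─ QR) (rep A)) / 1))
theorem14 = sumset≡QR⇒ , λ
  -- Since ε is at least 1/D for its denominator D = `suc d`, the threshold depends on D alone: p₀ =
  -- (D + 1)².
  { (mkℚ (+ ℕ.suc e) d c) _ → 1 ℕ.+ ℕ.suc d ℕ.* ℕ.suc d ℕ.+ 2 ℕ.* ℕ.suc d , λ p p> pr A →
      [1/6-ε]k≤M e d c ∣ A ∣ (∣ QR ─ sumset A ∣ ⊔ sumOver (sumset A ─ QR) (rep A)) (sumset-defect (ℕ.suc d) p p> (ℕ.s≤s ℕ.z≤n) pr A)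
  ; (mkℚ (+ ℕ.zero) _ _) record { pos = () }
  ; (mkℚ ℤ.-[1+ _ ] _ _) record { pos = () }
  }
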